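{- For any positive integer $n$, $$\sum_{\pi\in\mathcal S_n}s^{\mathrm{rmin}(\pi)}x^{p_{\rm silly}(\pi)}w^{\mathrm{des}(\pi)}=\sum_{M\in\mathcal N_n}s^{\min(M)}x^{\mathrm{rne}(M)}w^{\mathrm{int}(M)-1}.$$
   Context: **Permutations.** $\mathcal S_n$ is the set of permutations $\pi=\pi(1)\cdots\pi(n)$ of $[n]=\{1,\dots,n\}$. $\mathrm{rmin}(\pi)$ is the number of values $\pi(j)$ with $\pi(j)<\pi(k)$ for all $k>j$. $p_{\rm silly}(\pi)$ is the number of indices $j$ such that $j=1$ or $\pi(j-1)<\pi(j)$, $\pi(j)<n$, and the value $\pi(j)+1$ occurs to the left of $\pi(j)$ in $\pi(1)\cdots\pi(n)$. $\mathrm{des}(\pi)$ is the number of $j\in\{2,\dots,n\}$ with $\pi(j-1)>\pi(j)$. **Matchings.** A matching $M$ of size $n$ is a partition of $[2n]$ into 2-element arcs; an arc $A$ has opener $\mathrm{op}(A)=\min A$ and closer $\mathrm{cl}(A)=\max A$. Arcs are numbered $M_1,\dots,M_n$ by increasing closer. A left nesting is a pair of arcs $A,B$ with $\mathrm{op}(B)<\mathrm{op}(A)<\mathrm{cl}(A)<\mathrm{cl}(B)$ and $\mathrm{op}(A)=\mathrm{op}(B)+1$. $\mathcal N_n$ is the set of matchings of size $n$ with no left nesting. $\mathrm{rne}(M)$ is the number of $i$ with $\mathrm{op}(M_i)<\mathrm{op}(M_{i-1})<\mathrm{cl}(M_{i-1})=\mathrm{cl}(M_i)-1$. $\min(M)=\#\{i:\mathrm{op}(M_i)<\mathrm{cl}(M_1)\}$.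 $\mathrm{int}(M)=n-\#\{i\in\{2,\dots,n\}:\mathrm{cl}(M_{i-1})=\mathrm{cl}(M_i)-1\}$, i.e. the number of maximal runs of consecutive closers in $1,2,\dots,2n$. -}

module Defs where

open import Algebra.Bundles using (CommutativeSemiring)
open import Data.Fin using (Fin; toℕ; _<_)
open import Data.Fin.Properties using (_≟_; _<?_; all?; any?)
open import Data.List as List using (List; []; _∷_)
open import Data.Nat as ℕ using (ℕ; zero; suc; _∸_)
open import Data.Product using (∃-syntax; _×_; _,_; proj₁; proj₂)
open import Data.Sum using (_⊎_)
open import Data.Vec as Vec using (Vec; []; _∷_; lookup)
open import Function.Consequences.Propositional
  using (strictlySurjective⇒surjective; surjective⇒strictlySurjective)
open import Function.Definitions using (Injective; Surjective; Bijective)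
open import Level using (Level)
open import Relation.Binary.PropositionalEquality using (_≡_)
open import Relation.Nullary using (Dec; ¬_)
open import Relation.Nullary.Decidable
  using (map′; _×-dec_; _⊎-dec_; _→-dec_; ¬?)
open import Relation.Unary using (Pred; Decidable)

-- Throughout, [m] = {1,…,m} is Fin m, whose elements are shifted down by one:
-- the element k of [m] is the i : Fin m with suc (toℕ i) ≡ k.

private variable
  a p : Level
  A : Set a
  m n : ℕ

# : {P : Pred (Fin n) p} → Decidable P → ℕ
# {n = n} P? = Vec.count P? (Vec.allFin n)

-- i ⋖ j means i = j - 1.
_⋖_ : Fin m → Fin m → Set
i ⋖ j = suc (toℕ i) ≡ toℕ j

_⋖?_ : (i j : Fin m) → Dec (i ⋖ j)
i ⋖? j = suc (toℕ i) ℕ.≟ toℕ j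

-- Every vector of length k over xs, once each if xs has no repetitions.
vectors : List A → (k : ℕ) → List (Vec A k)
vectors xs zero    = [] ∷ []
vectors xs (suc k) = List.cartesianProductWith _∷_ xs (vectors xs k)

------------------------------------------------------------------------
-- Permutations, in one-line notation

Word : ℕ → Set
Word n = Vec (Fin n) n

IsPermutation : Word n → Set
IsPermutation π = Bijective _≡_ _≡_ (lookup π)

isPermutation? : Decidable (IsPermutation {n})
isPermutation? π = injective? ×-dec surjective?
  where
  injective? : Dec (Injective _≡_ _≡_ (lookup π))
  injective? = map′ (λ h {i} {j} → h i j) (λ h i j → h {i} {j})
    (all? λ i → all? λ j → (lookup π i ≟ lookup π j) →-dec (i ≟ j))

  surjective? : Dec (Surjective _≡_ _≡_ (lookup π))
  surjective? = map′
    strictlySurjective⇒surjective surjective⇒strictlySurjective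
    (all? λ v → any? λ j → lookup π j ≟ v)

𝒮 : (n : ℕ) → List (Word n)
𝒮 n = List.filter isPermutation? (vectors (List.allFin n) n)

module _ (π : Word n) where

  IsRightToLeftMin : Fin n → Set
  IsRightToLeftMin j = ∀ k → j < k → lookup π j < lookup π k

  isRightToLeftMin? : Decidable IsRightToLeftMin
  isRightToLeftMin? j = all? λ k → (j <? k) →-dec (lookup π j <? lookup π k)

  -- Positions of right-to-left minima; since the entries of a permutation
  -- are distinct, this also counts the values at those positions.
  rmin : ℕ
  rmin = # isRightToLeftMin?

  IsSilly : Fin n → Set
  IsSilly j =
      (toℕ j ≡ 0 ⊎ ∃[ i ] (i ⋖ j × lookup π i < lookup π j))
    × suc (toℕ (lookup π j)) ℕ.< n
    × ∃[ k ] (k < j × lookup π j ⋖ lookup π k)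

  isSilly? : Decidable IsSilly
  isSilly? j =
          ((toℕ j ℕ.≟ 0) ⊎-dec any? λ i → (i ⋖? j) ×-dec (lookup π i <? lookup π j))
    ×-dec (suc (toℕ (lookup π j)) ℕ.<? n)
    ×-dec (any? λ k → (k <? j) ×-dec (lookup π j ⋖? lookup π k))

  p-silly : ℕ
  p-silly = # isSilly?

  IsDescent : Fin n → Set
  IsDescent j = ∃[ i ] (i ⋖ j × lookup π j < lookup π i)

  isDescent? : Decidable IsDescent
  isDescent? j = any? λ i → (i ⋖? j) ×-dec (lookup π j <? lookup π i)

  des : ℕ
  des = # isDescent?

------------------------------------------------------------------------
-- Matchings

Arc : ℕ → Set
Arc m = Fin m × Fin m

op cl : Arc m → Fin m
op = proj₁
cl = proj₂

_∈ᵃ_ : Fin m → Arc m → Set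
q ∈ᵃ A = q ≡ op A ⊎ q ≡ cl A

_∈ᵃ?_ : (q : Fin m) (A : Arc m) → Dec (q ∈ᵃ A)
q ∈ᵃ? A = (q ≟ op A) ⊎-dec (q ≟ cl A)

ArcVec : ℕ → Set
ArcVec n = Vec (Arc (2 ℕ.* n)) n

-- A matching is stored as the vector M₁,…,Mₙ of its arcs in increasing order
-- of closers, so each set partition of [2n] into pairs has exactly one
-- representative.
record IsMatching (M : ArcVec n) : Set where
  constructor isMatching
  field
    op<cl      : ∀ i → op (lookup M i) < cl (lookup M i)
    partition  : ∀ q → ∃[ i ] (q ∈ᵃ lookup M i × (∀ j → q ∈ᵃ lookup M j → i ≡ j))
    increasing : ∀ i j → i < j → cl (lookup M i) < cl (lookup M j)

isMatching? : Decidable (IsMatching {n})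
isMatching? M = map′
  (λ (f , g , h) → isMatching f g h)
  (λ (isMatching f g h) → f , g , h)
  (     (all? λ i → op (lookup M i) <? cl (lookup M i))
  ×-dec (all? λ q → any? λ i → (q ∈ᵃ? lookup M i)
           ×-dec (all? λ j → (q ∈ᵃ? lookup M j) →-dec (i ≟ j)))
  ×-dec (all? λ i → all? λ j → (i <? j) →-dec (cl (lookup M i) <? cl (lookup M j))))

LeftNesting : Arc m → Arc m → Set
LeftNesting A B =
  (op B < op A × op A < cl A × cl A < cl B) × op B ⋖ op A

leftNesting? : (A B : Arc m) → Dec (LeftNesting A B)
leftNesting? A B =
  ((op B <? op A) ×-dec (op A <? cl A) ×-dec (cl A <? cl B)) ×-dec (op B ⋖? op A)

NoLeftNesting : ArcVec n → Set
NoLeftNesting M = ¬ (∃[ i ] ∃[ j ] LeftNesting (lookup M i) (lookup M j))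

noLeftNesting? : Decidable (NoLeftNesting {n})
noLeftNesting? M = ¬? (any? λ i → any? λ j → leftNesting? (lookup M i) (lookup M j))

𝒩 : (n : ℕ) → List (ArcVec n)
𝒩 n = List.filter (λ M → isMatching? M ×-dec noLeftNesting? M)
  (vectors (List.cartesianProduct (List.allFin (2 ℕ.* n)) (List.allFin (2 ℕ.* n))) n)

module _ (M : ArcVec n) where

  IsRightNesting : Fin n → Set
  IsRightNesting i = ∃[ h ] (h ⋖ i
    × op (lookup M i) < op (lookup M h)
    × op (lookup M h) < cl (lookup M h)
    × cl (lookup M h) ⋖ cl (lookup M i))

  isRightNesting? : Decidable IsRightNesting
  isRightNesting? i = any? λ h → (h ⋖? i)
    ×-dec (op (lookup M i) <? op (lookup M h))
    ×-dec (op (lookup M h) <? cl (lookup M h))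
    ×-dec (cl (lookup M h) ⋖? cl (lookup M i))

  rne : ℕ
  rne = # isRightNesting?

  -- The index f is that of M₁.
  OpensBeforeFirstCloser : Fin n → Set
  OpensBeforeFirstCloser i =
    ∃[ f ] (toℕ f ≡ 0 × op (lookup M i) < cl (lookup M f))

  opensBeforeFirstCloser? : Decidable OpensBeforeFirstCloser
  opensBeforeFirstCloser? i =
    any? λ f → (toℕ f ℕ.≟ 0) ×-dec (op (lookup M i) <? cl (lookup M f))

  min : ℕ
  min = # opensBeforeFirstCloser?

  ContinuesRun : Fin n → Set
  ContinuesRun i = ∃[ h ] (h ⋖ i × cl (lookup M h) ⋖ cl (lookup M i))

  continuesRun? : Decidable ContinuesRun
  continuesRun? i = any? λ h → (h ⋖? i) ×-dec (cl (lookup M h) ⋖? cl (lookup M i))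

  -- The index of M₁ never satisfies ContinuesRun, so the subtraction does not
  -- truncate, and int ≥ 1 whenever n ≥ 1.
  int : ℕ
  int = n ∸ # continuesRun?

------------------------------------------------------------------------
-- Generating functions

-- An identity between polynomials with natural number coefficients in
-- s, x, w is stated as an identity of their values at all elements s, x, w
-- of an arbitrary commutative semiring; the polynomial semiring ℕ[s,x,w] is
-- one instance.
module GeneratingFunction {c ℓ} (R : CommutativeSemiring c ℓ) where
  open CommutativeSemiring R public
    using (Carrier; _≈_; _+_; _*_; 0#; semiring)
  open import Algebra.Properties.Semiring.Exp semiring public using (_^_)

  ∑ : List A → (A → Carrier) → Carrier
  ∑ xs f = List.foldr _+_ 0# (List.map f xs)

  infix 5 ∑
  syntax ∑ xs (λ y → e) = ∑[ y ∈ xs ] e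

{-# OPTIONS --safe #-}
module Submission where

-- Permutations and matchings without left nestings are both coded by sequences a
-- with entries a 0, …, a (n - 1) and a i ≤ i.
--
-- In a matching, a i is the number of closers to the left of the opener of the arc
-- with index i.  Arcs with equal entries are those opened in one run of openers, and
-- without left nestings such a run has its openers in the order of the closers; so
-- the code determines the matching, and every code occurs (matchingCode-↭).
--
-- In a permutation, shift the values to 1, …, n and append 0.  Then a i is the right
-- neighbour of i + 1 once the values above i + 1 are erased; in other words, the
-- permutation is built by inserting 1, 2, … in turn, each directly to the left of a
-- chosen value (siteList-codes).
--
-- The zeros of a count min and rmin.  A value v with 1 ≤ v < n is unused by a if and
-- only if the closers with indices v - 1 and v are adjacent, or, for permutations, v
-- is not the second entry of a descent.  Among the unused values, rne counts those
-- with a v < a (v - 1).  The silly values are the unused v for which v + 1 stands to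
-- the left of v, that is, for which a v stands to the left of a (v - 1) in the word
-- at the time of the insertion of v + 1.  So both statistics compare the entries
-- around an unused value, but in different linear orders: the usual one, and the
-- order of positions in the growing word, in which 0 is least as well when it is read
-- from right to left; moreover one counts descents and the other ascents.
--
-- To compare them, give an unused value the weight x = 1 + d or y = 1 + e according
-- to the comparison, and expand the product over the unused values: a set of marked
-- values is chosen, marked values must remain unused, and a marked value has weight
-- d or e.  For a fixed set of marks the entries of the code run over the unmarked
-- values, so only their ranks among the unmarked values matter, and in this
-- description the two linear orders look alike.  An unmarked value imposes no
-- condition on the entries around it, so the sum over all codes is a product over the
-- blocks between unmarked values (pointer-sum); a block contributes the total weight
-- of the paths of a given length whose steps have weight d or e.  Ascents and descents
-- give transposed step weights, and reversing the paths shows that the totals agree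
-- (total-transpose).
--
-- This proves an identity of natural numbers for all s and all x, y ≥ 1.  It
-- determines all coefficients (coefficients-equal), hence the triples of statistics
-- of all codes agree up to order (stats-↭), and the sums agree in every commutative
-- semiring.

open import Defs
open import Algebra.Bundles using (CommutativeSemiring)
open import Data.Bool using (Bool; true; false; if_then_else_; not; _∧_; _∨_)
open import Data.Bool.ListAction using (all)
open import Data.Bool.Properties using (∨-zeroʳ; ∧-zeroʳ; ∧-conicalˡ; ∧-conicalʳ; ∨-assoc; ∨-comm)
open import Data.Empty using (⊥-elim)
open import Data.Fin as Fin using (Fin; zero; suc; toℕ; fromℕ; inject₁; fromℕ<; splitAt; punchOut; cast; join)
import Data.Fin.Properties as FinP
open import Data.Fin.Relation.Unary.Top using (view; ‵fromℕ; ‵inject₁)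
open import Data.List as List
  using (List; []; _∷_; _++_; map; downFrom; length; allFin; cartesianProduct; cartesianProductWith)
open import Data.List.Membership.Propositional using (_∈_; _∉_)
open import Data.List.Membership.Propositional.Properties
open import Data.List.Membership.Propositional.Properties.WithK using (unique∧set⇒bag)
open import Data.List.Properties using (map-∘; ∷-injective; ++-assoc; length-downFrom)
open import Data.List.Relation.Binary.BagAndSetEquality using (∼bag⇒↭)
open import Data.List.Relation.Binary.Permutation.Propositional as Perm
  using (_↭_; ↭-sym; ↭-trans; ↭-refl; ↭⇒↭ₛ)
import Data.List.Relation.Binary.Permutation.Propositional.Properties as ↭P
import Data.List.Relation.Binary.Permutation.Setoid.Properties as PSP
open import Data.List.Relation.Unary.All as All using (All; []; _∷_)
open import Data.List.Relation.Unary.AllPairs using ([]; _∷_)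
open import Data.List.Relation.Unary.Any as Any using (here; there)
open import Data.List.Relation.Unary.Unique.Propositional using (Unique)
import Data.List.Relation.Unary.Unique.Propositional.Properties as Unq
open import Data.Nat as ℕ
  using (ℕ; zero; suc; NonZero; _+_; _∸_; _⊔_; pred; _≤_; _<_; z≤n; s≤s; _≡ᵇ_; _<ᵇ_; _<?_; >-nonZero)
open import Data.Nat.DivMod using (_%_; [m+kn]%n≡m%n; m<n⇒m%n≡m)
open import Data.Nat.ListAction using (sum; product)
open import Data.Nat.ListAction.Properties using (sum-↭)
open import Data.Nat.Properties
open import Data.Nat.Tactic.RingSolver using (solve-∀)
open import Data.Product using (_×_; _,_; proj₁; proj₂; ∃-syntax)
open import Data.Sum using (_⊎_; inj₁; inj₂)
open import Data.Unit using (⊤; tt)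
open import Data.Vec as Vec using (Vec; []; _∷_; head; lookup; tabulate)
import Data.Vec.Properties as VecP
open import Function using (_∘_; id; mk⇔; case_of_)
open import Function.Consequences.Propositional
  using (strictlySurjective⇒surjective; surjective⇒strictlySurjective)
open import Function.Definitions using (Injective)
open import Level using (Level)
open import Relation.Binary.Definitions using (DecidableEquality; tri<; tri≈; tri>)
open import Relation.Binary.PropositionalEquality
open import Relation.Nullary using (Dec; yes; no; does; ¬_; contradiction)
open import Relation.Nullary.Decidable using (dec-true; dec-false; map′; _×-dec_)
open import Relation.Unary using (Pred; Decidable)

private variable
  ℓ₁ ℓ₂ : Level
  n k m : ℕ

-- Sums and products over lists
module Sums where
  open import Data.Nat using (_*_)
  open ≡-Reasoning
  private variable
    A : Set ℓ₁
    B : Set ℓ₂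

  Σ∈ Π∈ : List A → (A → ℕ) → ℕ
  Σ∈ xs f = sum (map f xs)
  Π∈ xs f = product (map f xs)

  Σ∈-cong : (xs : List A) {f g : A → ℕ} → (∀ x → x ∈ xs → f x ≡ g x) → Σ∈ xs f ≡ Σ∈ xs g
  Σ∈-cong []       eq = refl
  Σ∈-cong (x ∷ xs) eq = cong₂ _+_ (eq x (here refl)) (Σ∈-cong xs λ y → eq y ∘ there)

  Π∈-cong : (xs : List A) {f g : A → ℕ} → (∀ x → x ∈ xs → f x ≡ g x) → Π∈ xs f ≡ Π∈ xs g
  Π∈-cong []       eq = refl
  Π∈-cong (x ∷ xs) eq = cong₂ _*_ (eq x (here refl)) (Π∈-cong xs λ y → eq y ∘ there)

  Σ∈-* : (xs : List A) (k : ℕ) (f : A → ℕ) → Σ∈ xs (λ x → k * f x) ≡ k * Σ∈ xs f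
  Σ∈-* []       k f = sym (*-zeroʳ k)
  Σ∈-* (x ∷ xs) k f = trans (cong (k * f x +_) (Σ∈-* xs k f)) (sym (*-distribˡ-+ k (f x) _))

  +-interchange : ∀ a b c d → (a + b) + (c + d) ≡ (a + c) + (b + d)
  +-interchange = solve-∀

  *-interchange : ∀ a b c d → (a * b) * (c * d) ≡ (a * c) * (b * d)
  *-interchange = solve-∀

  Σ∈-+ : (xs : List A) (f g : A → ℕ) → Σ∈ xs (λ x → f x + g x) ≡ Σ∈ xs f + Σ∈ xs g
  Σ∈-+ []       f g = refl
  Σ∈-+ (x ∷ xs) f g = trans (cong (f x + g x +_) (Σ∈-+ xs f g)) (+-interchange (f x) (g x) _ _)

  Π∈-* : (xs : List A) (f g : A → ℕ) → Π∈ xs (λ x → f x * g x) ≡ Π∈ xs f * Π∈ xs g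
  Π∈-* []       f g = refl
  Π∈-* (x ∷ xs) f g = trans (cong (f x * g x *_) (Π∈-* xs f g)) (*-interchange (f x) (g x) _ _)

  Σ∈-zero : (xs : List A) → Σ∈ xs (λ _ → 0) ≡ 0
  Σ∈-zero []       = refl
  Σ∈-zero (x ∷ xs) = Σ∈-zero xs

  Π∈-one : (xs : List A) → Π∈ xs (λ _ → 1) ≡ 1
  Π∈-one []       = refl
  Π∈-one (x ∷ xs) = trans (+-identityʳ _) (Π∈-one xs)

  Σ∈-swap : (xs : List A) (ys : List B) (f : A → B → ℕ) →
            Σ∈ xs (λ x → Σ∈ ys (f x)) ≡ Σ∈ ys (λ y → Σ∈ xs (λ x → f x y))
  Σ∈-swap []       ys f = sym (Σ∈-zero ys)
  Σ∈-swap (x ∷ xs) ys f = trans (cong (Σ∈ ys (f x) +_) (Σ∈-swap xs ys f)) (sym (Σ∈-+ ys (f x) _))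

  Σ∈-map : (xs : List A) (h : A → B) (f : B → ℕ) → Σ∈ (map h xs) f ≡ Σ∈ xs (f ∘ h)
  Σ∈-map xs h f = cong sum (sym (map-∘ xs))

  Σ∈-++ : (xs ys : List A) (f : A → ℕ) → Σ∈ (xs ++ ys) f ≡ Σ∈ xs f + Σ∈ ys f
  Σ∈-++ []       ys f = refl
  Σ∈-++ (x ∷ xs) ys f = trans (cong (f x +_) (Σ∈-++ xs ys f)) (sym (+-assoc (f x) _ _))

  Σ∈-↭ : {xs ys : List A} (f : A → ℕ) → xs ↭ ys → Σ∈ xs f ≡ Σ∈ ys f
  Σ∈-↭ f p = sum-↭ (↭P.map⁺ f p)

  χ : Bool → ℕ
  χ b = if b then 1 else 0

open Sums

-- Weighted paths and their reversal
module Transposition where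
  open import Data.Nat using (_*_)
  open ≡-Reasoning

  -- Paths on the vertices 0, …, j - 1 in which a step from p to r has weight κ p r and
  -- a visit to the vertex 0 has weight s.  The last vertex of a path is not weighted in
  -- paths, but it is in total.
  module Paths (s : ℕ) (κ : ℕ → ℕ → ℕ) where

    zeroWeight : ℕ → ℕ
    zeroWeight zero    = s
    zeroWeight (suc _) = 1

    paths : ℕ → ℕ → ℕ → ℕ
    paths j zero    r = 1
    paths j (suc l) r = Σ∈ (downFrom j) λ p → zeroWeight p * paths j l p * κ p r

    total : ℕ → ℕ → ℕ
    total j l = Σ∈ (downFrom j) λ r → zeroWeight r * paths j l r

  module _ (s : ℕ) (κ : ℕ → ℕ → ℕ) where
    private
      module P = Paths s κ
      module Q = Paths s (λ p r → κ r p)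

      -- Paths of length l + m are cut at their vertex number l.  The m steps after the cut
      -- are read backwards, which transposes κ.
      pairing : ℕ → ℕ → ℕ → ℕ
      pairing j l m = Σ∈ (downFrom j) λ r → P.zeroWeight r * P.paths j l r * Q.paths j m r

      zeroWeight-eq : ∀ r → Q.zeroWeight r ≡ P.zeroWeight r
      zeroWeight-eq zero    = refl
      zeroWeight-eq (suc _) = refl

      -- Moves the cut back by one vertex.
      pairing-shift : ∀ j l m → pairing j (suc l) m ≡ pairing j l (suc m)
      pairing-shift j l m = begin
        pairing j (suc l) m
          ≡⟨ (Σ∈-cong (downFrom j) λ r _ → trans
               (move (P.zeroWeight r) _ (Q.paths j m r))
               (sym (Σ∈-* (downFrom j) (P.zeroWeight r * Q.paths j m r) _))) ⟩
        Σ∈ (downFrom j) (λ r → Σ∈ (downFrom j) λ p →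
          (P.zeroWeight r * Q.paths j m r) * (P.zeroWeight p * P.paths j l p * κ p r))
          ≡⟨ Σ∈-swap (downFrom j) (downFrom j) _ ⟩
        Σ∈ (downFrom j) (λ p → Σ∈ (downFrom j) λ r →
          (P.zeroWeight r * Q.paths j m r) * (P.zeroWeight p * P.paths j l p * κ p r))
          ≡⟨ (Σ∈-cong (downFrom j) λ p _ → trans
               (Σ∈-cong (downFrom j) λ r _ → trans
                 (move′ (P.zeroWeight r * Q.paths j m r) (P.zeroWeight p * P.paths j l p) (κ p r))
                 (cong (λ z → P.zeroWeight p * P.paths j l p * (z * Q.paths j m r * κ p r)) (sym (zeroWeight-eq r))))
               (Σ∈-* (downFrom j) (P.zeroWeight p * P.paths j l p) _)) ⟩
        pairing j l (suc m) ∎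
        where
        move : ∀ a b c → a * b * c ≡ a * c * b
        move = solve-∀
        move′ : ∀ a b c → a * (b * c) ≡ b * (a * c)
        move′ = solve-∀

      pairing-invariant : ∀ j l m → pairing j (l + m) 0 ≡ pairing j l m
      pairing-invariant j l zero    = cong (λ k → pairing j k 0) (+-identityʳ l)
      pairing-invariant j l (suc m) = begin
        pairing j (l + suc m) 0 ≡⟨ cong (λ k → pairing j k 0) (+-suc l m) ⟩
        pairing j (suc l + m) 0 ≡⟨ pairing-invariant j (suc l) m ⟩
        pairing j (suc l) m     ≡⟨ pairing-shift j l m ⟩
        pairing j l (suc m)     ∎

    total-transpose : ∀ j l → P.total j l ≡ Q.total j l
    total-transpose j l = begin
      P.total j l       ≡⟨ (Σ∈-cong (downFrom j) λ r _ → sym (*-identityʳ _)) ⟩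
      pairing j l 0     ≡⟨ pairing-invariant j 0 l ⟩
      pairing j 0 l     ≡⟨ (Σ∈-cong (downFrom j) λ r _ → cong (_* Q.paths j l r)
                              (trans (*-identityʳ _) (sym (zeroWeight-eq r)))) ⟩
      Q.total j l       ∎

open Transposition

-- Recovering coefficients from values
module Coefficients where
  open import Data.Nat using (_*_; _^_)
  open ≡-Reasoning
  private variable
    A : Set ℓ₁

  module _ (xs : List A) where

    split-constant : ∀ (c e : A → ℕ) B → Σ∈ xs (λ a → c a * B ^ e a)
      ≡ Σ∈ xs (λ a → χ (e a ≡ᵇ 0) * c a)
        + Σ∈ xs (λ a → χ (not (e a ≡ᵇ 0)) * c a * B ^ pred (e a)) * B
    split-constant c e B = begin
      Σ∈ xs (λ a → c a * B ^ e a)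
        ≡⟨ (Σ∈-cong xs λ a _ → split (c a) (e a)) ⟩
      Σ∈ xs (λ a → χ (e a ≡ᵇ 0) * c a + B * (χ (not (e a ≡ᵇ 0)) * c a * B ^ pred (e a)))
        ≡⟨ Σ∈-+ xs _ _ ⟩
      Σ∈ xs (λ a → χ (e a ≡ᵇ 0) * c a) + Σ∈ xs (λ a → B * (χ (not (e a ≡ᵇ 0)) * c a * B ^ pred (e a)))
        ≡⟨ cong (Σ∈ xs (λ a → χ (e a ≡ᵇ 0) * c a) +_) (trans (Σ∈-* xs B _) (*-comm B _)) ⟩
      _ ∎
      where
      split : ∀ c e → c * B ^ e ≡ χ (e ≡ᵇ 0) * c + B * (χ (not (e ≡ᵇ 0)) * c * B ^ pred e)
      split c zero    = lem c B where
        lem : ∀ c B → c * 1 ≡ c + 0 + B * 0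
        lem = solve-∀
      split c (suc e) = lem c B (B ^ e) where
        lem : ∀ c B D → c * (B * D) ≡ B * ((c + 0) * D)
        lem = solve-∀

    -- For B above both constant terms these are the remainders of the two values modulo
    -- B.  Once they are cancelled, division by B lowers all exponents by one, whence
    -- induction on k.  The thresholds β grow along the induction, which is why the
    -- hypothesis only concerns large B.
    coefficients-equal : ∀ k (c e c′ e′ : A → ℕ) (β : ℕ) →
      (∀ B → β ≤ B → Σ∈ xs (λ a → c a * B ^ e a) ≡ Σ∈ xs (λ a → c′ a * B ^ e′ a)) →
      Σ∈ xs (λ a → χ (e a ≡ᵇ k) * c a) ≡ Σ∈ xs (λ a → χ (e′ a ≡ᵇ k) * c′ a)
    coefficients-equal k c e c′ e′ β eq = go k
      where
      low low′ : ℕ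
      low  = Σ∈ xs (λ a → χ (e a ≡ᵇ 0) * c a)
      low′ = Σ∈ xs (λ a → χ (e′ a ≡ᵇ 0) * c′ a)
      high high′ : ℕ → ℕ
      high  B = Σ∈ xs (λ a → χ (not (e a ≡ᵇ 0)) * c a * B ^ pred (e a))
      high′ B = Σ∈ xs (λ a → χ (not (e′ a ≡ᵇ 0)) * c′ a * B ^ pred (e′ a))

      bound : ℕ
      bound = β ⊔ suc (low ⊔ low′)

      module _ (B : ℕ) (bound≤B : bound ≤ B) where
        low<B : low < B
        low<B = ≤-trans (s≤s (m≤m⊔n low low′)) (≤-trans (m≤n⊔m β _) bound≤B)
        low′<B : low′ < B
        low′<B = ≤-trans (s≤s (m≤n⊔m low low′)) (≤-trans (m≤n⊔m β _) bound≤B)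
        instance
          B≢0 : NonZero B
          B≢0 = >-nonZero (≤-trans (s≤s z≤n) low<B)

        split-eq : low + high B * B ≡ low′ + high′ B * B
        split-eq = begin
          low + high B * B                ≡⟨ split-constant c e B ⟨
          Σ∈ xs (λ a → c a * B ^ e a)     ≡⟨ eq B (≤-trans (m≤m⊔n β _) bound≤B) ⟩
          Σ∈ xs (λ a → c′ a * B ^ e′ a)   ≡⟨ split-constant c′ e′ B ⟩
          low′ + high′ B * B              ∎

        low-eq : low ≡ low′
        low-eq = begin
          low                          ≡⟨ m<n⇒m%n≡m low<B ⟨
          low % B                      ≡⟨ [m+kn]%n≡m%n low (high B) B ⟨
          (low + high B * B) % B       ≡⟨ cong (_% B) split-eq ⟩
          (low′ + high′ B * B) % B     ≡⟨ [m+kn]%n≡m%n low′ (high′ B) B ⟩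
          low′ % B                     ≡⟨ m<n⇒m%n≡m low′<B ⟩
          low′                         ∎

        high-eq : high B ≡ high′ B
        high-eq = *-cancelʳ-≡ (high B) (high′ B) B
          (+-cancelˡ-≡ low _ _ (trans split-eq (cong (_+ high′ B * B) (sym low-eq))))

      shift-index : ∀ k (c e : A → ℕ) →
        Σ∈ xs (λ a → χ (pred (e a) ≡ᵇ k) * (χ (not (e a ≡ᵇ 0)) * c a))
          ≡ Σ∈ xs (λ a → χ (e a ≡ᵇ suc k) * c a)
      shift-index k c e = Σ∈-cong xs λ a _ → pointwise (c a) (e a)
        where
        pointwise : ∀ c e → χ (pred e ≡ᵇ k) * (χ (not (e ≡ᵇ 0)) * c) ≡ χ (e ≡ᵇ suc k) * c
        pointwise c zero    = *-zeroʳ (χ (0 ≡ᵇ k))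
        pointwise c (suc e) = cong (χ (e ≡ᵇ k) *_) (+-identityʳ c)

      go : ∀ k → Σ∈ xs (λ a → χ (e a ≡ᵇ k) * c a) ≡ Σ∈ xs (λ a → χ (e′ a ≡ᵇ k) * c′ a)
      go zero    = low-eq bound ≤-refl
      go (suc k) = begin
        _ ≡⟨ shift-index k c e ⟨
        _ ≡⟨ coefficients-equal k (λ a → χ (not (e a ≡ᵇ 0)) * c a) (pred ∘ e)
                               (λ a → χ (not (e′ a ≡ᵇ 0)) * c′ a) (pred ∘ e′) bound high-eq ⟩
        _ ≡⟨ shift-index k c′ e′ ⟩
        _ ∎

  module _ (_≟_ : DecidableEquality A) where

    occurrences : A → List A → ℕ
    occurrences t xs = Σ∈ xs λ u → χ (does (u ≟ t))

    occurrences-here : ∀ x xs → occurrences x (x ∷ xs) ≡ suc (occurrences x xs)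
    occurrences-here x xs with x ≟ x
    ... | yes _  = refl
    ... | no x≢x = ⊥-elim (x≢x refl)

    occurs⇒∈ : ∀ x ys → occurrences x ys ≢ 0 → x ∈ ys
    occurs⇒∈ x []       nz = ⊥-elim (nz refl)
    occurs⇒∈ x (y ∷ ys) nz with y ≟ x
    ... | yes refl = here refl
    ... | no _     = there (occurs⇒∈ x ys nz)

    occurrences⇒↭ : ∀ xs ys → (∀ t → occurrences t xs ≡ occurrences t ys) → xs ↭ ys
    occurrences⇒↭ [] []       eq = ↭-refl
    occurrences⇒↭ [] (y ∷ ys) eq with () ← trans (eq y) (occurrences-here y ys)
    occurrences⇒↭ (x ∷ xs) ys eq
      with α , β , refl ← ∈-∃++ (occurs⇒∈ x ys λ z → 0≢1+n
             (trans (sym z) (trans (sym (eq x)) (occurrences-here x xs))))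
      = ↭-trans (Perm.prep x (occurrences⇒↭ xs (α ++ β) λ t →
          +-cancelˡ-≡ (χ (does (x ≟ t))) _ _
            (trans (eq t) (Σ∈-↭ _ (↭P.shift x α β)))))
        (↭-sym (↭P.shift x α β))

  Triple : Set
  Triple = ℕ × ℕ × ℕ

  _≟³_ : DecidableEquality Triple
  (i , j , k) ≟³ (i′ , j′ , k′) =
    map′ (λ { (refl , refl , refl) → refl }) (λ { refl → refl , refl , refl })
         ((i ≟ i′) ×-dec (j ≟ j′) ×-dec (k ≟ k′))

  χ-∧₃ : ∀ a b c → χ (a ∧ b ∧ c) ≡ χ c * (χ b * (χ a * 1))
  χ-∧₃ true  true  true  = refl
  χ-∧₃ true  true  false = refl
  χ-∧₃ true  false c     = sym (*-zeroʳ (χ c))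
  χ-∧₃ false b     c     = sym (trans (cong (χ c *_) (*-zeroʳ (χ b))) (*-zeroʳ (χ c)))

  monomial : ℕ → ℕ → ℕ → Triple → ℕ
  monomial s x y (i , j , k) = s ^ i * (x ^ j * y ^ k)

  -- The coefficients are extracted one variable at a time, with the other variables
  -- fixed; what remains at the end is the number of occurrences of a triple.
  monomial-sums⇒↭ : (xs : List A) (t t′ : A → Triple) →
    (∀ s x y → 1 ≤ s → 1 ≤ x → 1 ≤ y →
       Σ∈ xs (monomial s x y ∘ t) ≡ Σ∈ xs (monomial s x y ∘ t′)) →
    map t xs ↭ map t′ xs
  monomial-sums⇒↭ xs t t′ eq = occurrences⇒↭ _≟³_ _ _ λ (i , j , k) → begin
    occurrences _≟³_ (i , j , k) (map t xs)
      ≡⟨ spread t i j k ⟩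
    _ ≡⟨ (coefficients-equal xs k _ (Y t) _ (Y t′) 1 λ y y≥1 → begin
      _ ≡⟨ (Σ∈-cong xs λ a _ → to-y i j y (t a)) ⟨
      _ ≡⟨ (coefficients-equal xs j _ (X t) _ (X t′) 1 λ x x≥1 → begin
        _ ≡⟨ (Σ∈-cong xs λ a _ → to-x i x y (t a)) ⟨
        _ ≡⟨ (coefficients-equal xs i _ (Z t) _ (Z t′) 1 λ s s≥1 → begin
          _ ≡⟨ (Σ∈-cong xs λ a _ → *-comm (s ^ Z t a) _) ⟨
          _ ≡⟨ eq s x y s≥1 x≥1 y≥1 ⟩
          _ ≡⟨ (Σ∈-cong xs λ a _ → *-comm (s ^ Z t′ a) _) ⟩
          _ ∎) ⟩
        _ ≡⟨ (Σ∈-cong xs λ a _ → to-x i x y (t′ a)) ⟩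
        _ ∎) ⟩
      _ ≡⟨ (Σ∈-cong xs λ a _ → to-y i j y (t′ a)) ⟩
      _ ∎) ⟩
    _
      ≡⟨ spread t′ i j k ⟨
    occurrences _≟³_ (i , j , k) (map t′ xs) ∎
    where
    Z X Y : (_ → Triple) → _ → ℕ
    Z t a = proj₁ (t a)
    X t a = proj₁ (proj₂ (t a))
    Y t a = proj₂ (proj₂ (t a))

    spread : ∀ t i j k → occurrences _≟³_ (i , j , k) (map t xs)
           ≡ Σ∈ xs (λ a → χ (Y t a ≡ᵇ k) * (χ (X t a ≡ᵇ j) * (χ (Z t a ≡ᵇ i) * 1)))
    spread t i j k = trans (Σ∈-map xs t _) (Σ∈-cong xs λ a _ → χ-∧₃ (Z t a ≡ᵇ i) (X t a ≡ᵇ j) (Y t a ≡ᵇ k))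

    to-x : ∀ i x y ((z , p , q) : Triple) →
           χ (z ≡ᵇ i) * (x ^ p * y ^ q) ≡ (χ (z ≡ᵇ i) * y ^ q) * x ^ p
    to-x i x y (z , p , q) = lem (χ (z ≡ᵇ i)) (x ^ p) (y ^ q)
      where
      lem : ∀ a b c → a * (b * c) ≡ (a * c) * b
      lem = solve-∀

    to-y : ∀ i j y ((z , p , q) : Triple) →
           χ (p ≡ᵇ j) * (χ (z ≡ᵇ i) * y ^ q) ≡ (χ (p ≡ᵇ j) * (χ (z ≡ᵇ i) * 1)) * y ^ q
    to-y i j y (z , p , q) = lem (χ (p ≡ᵇ j)) (χ (z ≡ᵇ i)) (y ^ q)
      where
      lem : ∀ a b c → a * (b * c) ≡ (a * (b * 1)) * c
      lem = solve-∀

open Coefficients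

-- Inversion sequences
module Codes where
  open ≡-Reasoning

  ≡ᵇ-refl : ∀ m → (m ≡ᵇ m) ≡ true
  ≡ᵇ-refl m = dec-true (m ≟ m) refl

  ≢⇒≡ᵇ : ∀ {m n} → m ≢ n → (m ≡ᵇ n) ≡ false
  ≢⇒≡ᵇ {m} {n} = dec-false (m ≟ n)

  -- The last entry of a sequence is stored first, so that a sequence is extended by
  -- _∷_.
  codes : ∀ n → List (Vec ℕ n)
  codes zero    = [] ∷ []
  codes (suc n) = cartesianProductWith _∷_ (downFrom (suc n)) (codes n)

  IsCode : Vec ℕ n → Set
  IsCode []               = ⊤
  IsCode {suc n} (c ∷ as) = c ≤ n × IsCode as

  ∈-codes⁺ : (a : Vec ℕ n) → IsCode a → a ∈ codes n
  ∈-codes⁺ []       _           = here refl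
  ∈-codes⁺ (c ∷ as) (c≤n , ok) = ∈-cartesianProductWith⁺ _∷_ (∈-downFrom⁺ (s≤s c≤n)) (∈-codes⁺ as ok)

  ∈-codes⁻ : (a : Vec ℕ n) → a ∈ codes n → IsCode a
  ∈-codes⁻ []       _ = tt
  ∈-codes⁻ {suc n} (c ∷ as) a∈
    with _ , _ , c∈ , as∈ , refl ← ∈-cartesianProductWith⁻ _∷_ (downFrom (suc n)) (codes n) a∈
    = ≤-pred (∈-downFrom⁻ c∈) , ∈-codes⁻ as as∈

  codes-unique : ∀ n → Unique (codes n)
  codes-unique zero    = [] ∷ []
  codes-unique (suc n) = Unq.cartesianProductWith⁺ _∷_ (λ { refl → refl , refl })
                           (Unq.downFrom⁺ (suc n)) (codes-unique n)

  Σ∈-codes : ∀ n (f : Vec ℕ (suc n) → ℕ) →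
             Σ∈ (codes (suc n)) f ≡ Σ∈ (codes n) λ as → Σ∈ (downFrom (suc n)) λ c → f (c ∷ as)
  Σ∈-codes n f = trans (over-product (downFrom (suc n)))
                       (Σ∈-swap (downFrom (suc n)) (codes n) λ c as → f (c ∷ as))
    where
    over-product : ∀ cs → Σ∈ (cartesianProductWith _∷_ cs (codes n)) f
                   ≡ Σ∈ cs λ c → Σ∈ (codes n) λ as → f (c ∷ as)
    over-product []       = refl
    over-product (c ∷ cs) = trans (Σ∈-++ (map (c ∷_) (codes n)) _ f)
                             (cong₂ _+_ (Σ∈-map (codes n) (c ∷_) f) (over-product cs))

  mem : ℕ → Vec ℕ n → Bool
  mem i []       = false
  mem i (c ∷ as) = (i ≡ᵇ c) ∨ mem i as

  -- The entries of a code of length n are below n.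
  mem-fresh : (a : Vec ℕ n) → IsCode a → ∀ i → n ≤ i → mem i a ≡ false
  mem-fresh []       _          i n≤i = refl
  mem-fresh (c ∷ as) (c≤n , ok) i n<i
    rewrite ≢⇒≡ᵇ {i} {c} (λ { refl → <⇒≱ n<i c≤n }) = mem-fresh as ok i (<⇒≤ n<i)

  zeros : Vec ℕ n → ℕ
  zeros []       = 0
  zeros (c ∷ as) = χ (c ≡ᵇ 0) + zeros as

open Codes

-- Expansion of a product over subsets
module Marks where
  open import Data.Nat using (_*_)
  open ≡-Reasoning

  -- Characteristic functions on ℕ that vanish from k on, so that passing from k to
  -- suc k only decides about k.
  subsets : ℕ → List (ℕ → Bool)
  subsets zero    = (λ _ → false) ∷ []
  subsets (suc k) = subsets k ++ map (λ μ v → (v ≡ᵇ k) ∨ μ v) (subsets k)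

  subsets-bounded : ∀ k {μ} → μ ∈ subsets k → ∀ v → k ≤ v → μ v ≡ false
  subsets-bounded zero    (here refl) v _ = refl
  subsets-bounded (suc k) μ∈ v k<v with ∈-++⁻ (subsets k) μ∈
  ... | inj₁ μ∈′ = subsets-bounded k μ∈′ v (<⇒≤ k<v)
  ... | inj₂ μ∈′ with μ , μ∈″ , refl ← ∈-map⁻ _ μ∈′
    rewrite ≢⇒≡ᵇ {v} {k} (≢-sym (<⇒≢ k<v)) = subsets-bounded k μ∈″ v (<⇒≤ k<v)

  Π-expand : ∀ k (g : ℕ → Bool → ℕ) →
    Π∈ (downFrom k) (λ v → g v false + g v true) ≡ Σ∈ (subsets k) λ μ → Π∈ (downFrom k) λ v → g v (μ v)
  Π-expand zero    g = refl
  Π-expand (suc k) g = begin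
    (g k false + g k true) * Π∈ (downFrom k) (λ v → g v false + g v true)
      ≡⟨ cong ((g k false + g k true) *_) (Π-expand k g) ⟩
    (g k false + g k true) * Σ∈ (subsets k) P
      ≡⟨ *-distribʳ-+ (Σ∈ (subsets k) P) (g k false) (g k true) ⟩
    g k false * Σ∈ (subsets k) P + g k true * Σ∈ (subsets k) P
      ≡⟨ cong₂ _+_ (sym (Σ∈-* (subsets k) (g k false) P)) (sym (Σ∈-* (subsets k) (g k true) P)) ⟩
    Σ∈ (subsets k) (λ μ → g k false * P μ) + Σ∈ (subsets k) (λ μ → g k true * P μ)
      ≡⟨ cong₂ _+_
           (Σ∈-cong (subsets k) λ μ μ∈ → cong (λ b → g k b * P μ) (sym (subsets-bounded k μ∈ k ≤-refl)))
           (Σ∈-cong (subsets k) λ μ μ∈ → cong₂ _*_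
             (cong (λ b → g k (b ∨ μ k)) (sym (≡ᵇ-refl k)))
             (Π∈-cong (downFrom k) λ v v∈ →
               cong (λ b → g v (b ∨ μ v)) (sym (≢⇒≡ᵇ (<⇒≢ (∈-downFrom⁻ v∈)))))) ⟩
    Σ∈ (subsets k) P′ + Σ∈ (subsets k) (P′ ∘ λ μ v → (v ≡ᵇ k) ∨ μ v)
      ≡⟨ cong (Σ∈ (subsets k) P′ +_) (Σ∈-map (subsets k) _ P′) ⟨
    Σ∈ (subsets k) P′ + Σ∈ (map (λ μ v → (v ≡ᵇ k) ∨ μ v) (subsets k)) P′
      ≡⟨ Σ∈-++ (subsets k) _ P′ ⟨
    Σ∈ (subsets (suc k)) P′ ∎
    where
    P P′ : (ℕ → Bool) → ℕ
    P  μ = Π∈ (downFrom k) λ v → g v (μ v)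
    P′ μ = Π∈ (downFrom (suc k)) λ v → g v (μ v)

open Marks

-- Ranks in a list
module Ranks where
  open import Data.Nat using (_*_)
  open ≡-Reasoning

  unique-resp-↭ : ∀ {xs ys : List ℕ} → xs ↭ ys → Unique xs → Unique ys
  unique-resp-↭ p = PSP.Unique-resp-↭ (setoid ℕ) (↭⇒↭ₛ p)

  -- The position of c, counted from the right end, in the sublist of the elements
  -- that satisfy o.
  rank : (ℕ → Bool) → ℕ → List ℕ → ℕ
  rank o c []       = 0
  rank o c (y ∷ ys) = if c ≡ᵇ y then Σ∈ ys (χ ∘ o) else rank o c ys

  -- From right to left, the elements that satisfy o have the ranks 0, 1, 2, ….
  Σ-rank : ∀ o {ys} → Unique ys → (g : ℕ → ℕ) →
    Σ∈ ys (λ c → χ (o c) * g (rank o c ys)) ≡ Σ∈ (downFrom (Σ∈ ys (χ ∘ o))) g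
  Σ-rank o []                      g = refl
  Σ-rank o {y ∷ ys} (y∉ys ∷ uniq) g = begin
    χ (o y) * g (rank o y (y ∷ ys)) + Σ∈ ys (λ c → χ (o c) * g (rank o c (y ∷ ys)))
      ≡⟨ cong₂ _+_
           (cong (λ b → χ (o y) * g (if b then Σ∈ ys (χ ∘ o) else rank o y ys)) (≡ᵇ-refl y))
           (Σ∈-cong ys λ c c∈ → cong (λ b → χ (o c) * g (if b then Σ∈ ys (χ ∘ o) else rank o c ys))
             (≢⇒≡ᵇ (≢-sym (All.lookup y∉ys c∈)))) ⟩
    χ (o y) * g (Σ∈ ys (χ ∘ o)) + Σ∈ ys (λ c → χ (o c) * g (rank o c ys))
      ≡⟨ cong (χ (o y) * g (Σ∈ ys (χ ∘ o)) +_) (Σ-rank o uniq g) ⟩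
    χ (o y) * g (Σ∈ ys (χ ∘ o)) + Σ∈ (downFrom (Σ∈ ys (χ ∘ o))) g
      ≡⟨ lem (o y) ⟩
    Σ∈ (downFrom (χ (o y) + Σ∈ ys (χ ∘ o))) g ∎
    where
    lem : ∀ b → χ b * g (Σ∈ ys (χ ∘ o)) + Σ∈ (downFrom (Σ∈ ys (χ ∘ o))) g
              ≡ Σ∈ (downFrom (χ b + Σ∈ ys (χ ∘ o))) g
    lem true  = cong (_+ Σ∈ (downFrom (Σ∈ ys (χ ∘ o))) g) (+-identityʳ _)
    lem false = refl

  <⇒<ᵇ≡true : ∀ {m n} → m < n → (m <ᵇ n) ≡ true
  <⇒<ᵇ≡true {m} {n} = dec-true (m <? n)

  ≥⇒<ᵇ≡false : ∀ {m n} → n ≤ m → (m <ᵇ n) ≡ false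
  ≥⇒<ᵇ≡false {m} {n} n≤m = dec-false (m <? n) (≤⇒≯ n≤m)

  rank-here : ∀ o c ys → rank o c (c ∷ ys) ≡ Σ∈ ys (χ ∘ o)
  rank-here o c ys = cong (λ b → if b then Σ∈ ys (χ ∘ o) else rank o c ys) (≡ᵇ-refl c)

  rank-there : ∀ o {c y} ys → c ≢ y → rank o c (y ∷ ys) ≡ rank o c ys
  rank-there o {c} ys c≢y = cong (λ b → if b then Σ∈ ys (χ ∘ o) else rank o c ys) (≢⇒≡ᵇ c≢y)

  rank-≤ : ∀ o c ys → rank o c ys ≤ Σ∈ ys (χ ∘ o)
  rank-≤ o c []       = z≤n
  rank-≤ o c (y ∷ ys) with c ≡ᵇ y
  ... | true  = m≤n+m _ (χ (o y))
  ... | false = ≤-trans (rank-≤ o c ys) (m≤n+m _ (χ (o y)))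

  rank-< : ∀ o {c} ys → c ∈ ys → o c ≡ true → rank o c ys < Σ∈ ys (χ ∘ o)
  rank-< o {c} (y ∷ ys) c∈ oc with c ≟ y
  ... | yes refl = subst₂ _<_ (sym (rank-here o c ys)) (cong (λ b → χ b + Σ∈ ys (χ ∘ o)) (sym oc)) ≤-refl
  ... | no c≢y with c∈
  ...   | here c≡y  = ⊥-elim (c≢y c≡y)
  ...   | there c∈′ = subst (_< _) (sym (rank-there o ys c≢y))
                        (<-≤-trans (rank-< o ys c∈′ oc) (m≤n+m _ (χ (o y))))

open Ranks

-- Codes generated along a moving linear order
module Trees where
  open import Data.Nat using (_*_; _^_)
  open ≡-Reasoning

  -- A linear order on the values 0, …, n that may extend a code of length n: sites
  -- lists them, 0 being last.  Extending the code by c puts the next value somewhere to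
  -- the left of c, so that the rank of c does not change.  An extension rises if it
  -- compares with the previous entry, by rank, as lt prescribes; this is only required
  -- when the value added last is avoided, since the comparison is ignored otherwise.
  -- The quantification over o makes every choice of unmarked values available.
  record Tree (lt : ℕ → ℕ → Bool) : Set where
    field
      sites : Vec ℕ n → List ℕ
      rises : Vec ℕ (suc k) → ℕ → Bool
      sites-↭ : (a : Vec ℕ n) → IsCode a → sites a ↭ downFrom (suc n)
      rank-child : ∀ (a : Vec ℕ n) c → IsCode a → c ≤ n → ∀ o →
                   rank o c (sites (c ∷ a)) ≡ rank o c (sites a)
      rank-zero : ∀ (a : Vec ℕ n) c → IsCode a → c ≤ n → ∀ o → o 0 ≡ true → o c ≡ true →
                  (c ≡ᵇ 0) ≡ (rank o c (sites a) ≡ᵇ 0)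
      rises-rank : ∀ (a : Vec ℕ (suc k)) c → IsCode a → c ≤ k → ∀ o → o (head a) ≡ true → o c ≡ true →
                   rises a c ≡ lt (rank o (head a) (sites a)) (rank o c (sites a))

    -- The entries with numbers v and suc v are compared; their comparison belongs to
    -- the value suc v.
    rise : Vec ℕ n → ℕ → Bool
    rise []                       v = false
    rise (c ∷ [])                 v = false
    rise {suc (suc k)} (c ∷ as@(_ ∷ _)) v = if v ≡ᵇ k then rises as c else rise as v

    unusedRises unusedRests : Vec ℕ (suc k) → ℕ
    unusedRises {k} a = Σ∈ (downFrom k) (λ v → χ (not (mem (suc v) a) ∧ rise a v))
    unusedRests {k} a = Σ∈ (downFrom k) (λ v → χ (not (mem (suc v) a) ∧ not (rise a v)))

    stats : Vec ℕ (suc k) → Triple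
    stats a = zeros a , unusedRises a , unusedRests a

  -- The mark v belongs to the value suc v; the value 0 is never marked.
  open-site : (ℕ → Bool) → ℕ → Bool
  open-site μ zero    = true
  open-site μ (suc v) = not (μ v)

  factor : ℕ → ℕ → Bool → Bool → ℕ
  factor x y true  _     = 1
  factor x y false true  = x
  factor x y false false = y

  monomial-factor : ∀ s x y z (f g : ℕ → Bool) vs →
    monomial s x y (z , Σ∈ vs (λ v → χ (not (f v) ∧ g v)) , Σ∈ vs (λ v → χ (not (f v) ∧ not (g v))))
    ≡ s ^ z * Π∈ vs (λ v → factor x y (f v) (g v))
  monomial-factor s x y z f g vs = cong (s ^ z *_) (go vs)
    where
    one : ∀ u r → x ^ χ (not u ∧ r) * y ^ χ (not u ∧ not r) ≡ factor x y u r
    one true  _     = refl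
    one false true  = trans (*-identityʳ (x * 1)) (*-identityʳ x)
    one false false = trans (*-identityˡ (y * 1)) (*-identityʳ y)
    go : ∀ vs → x ^ Σ∈ vs (λ v → χ (not (f v) ∧ g v)) * y ^ Σ∈ vs (λ v → χ (not (f v) ∧ not (g v)))
       ≡ Π∈ vs (λ v → factor x y (f v) (g v))
    go []       = refl
    go (v ∷ vs) = begin
      x ^ (χ (not (f v) ∧ g v) + A) * y ^ (χ (not (f v) ∧ not (g v)) + B)
        ≡⟨ cong₂ _*_ (^-distribˡ-+-* x (χ (not (f v) ∧ g v)) A) (^-distribˡ-+-* y (χ (not (f v) ∧ not (g v))) B) ⟩
      (x ^ χ (not (f v) ∧ g v) * x ^ A) * (y ^ χ (not (f v) ∧ not (g v)) * y ^ B)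
        ≡⟨ *-interchange (x ^ χ (not (f v) ∧ g v)) (x ^ A) _ (y ^ B) ⟩
      (x ^ χ (not (f v) ∧ g v) * y ^ χ (not (f v) ∧ not (g v))) * (x ^ A * y ^ B)
        ≡⟨ cong₂ _*_ (one (f v) (g v)) (go vs) ⟩
      factor x y (f v) (g v) * Π∈ vs (λ v → factor x y (f v) (g v)) ∎
      where
      A = Σ∈ vs (λ v → χ (not (f v) ∧ g v))
      B = Σ∈ vs (λ v → χ (not (f v) ∧ not (g v)))

  χ-not-∧-false : ∀ b → χ (not (b ∧ false)) ≡ 1
  χ-not-∧-false true  = refl
  χ-not-∧-false false = refl

  -- A factor differs from 1 only if it belongs to c, and k < c leaves no such factor.
  open-product-beyond : ∀ (μ : ℕ → Bool) c k → k < c → Π∈ (downFrom k) (λ v → χ (not (μ v ∧ (suc v ≡ᵇ c)))) ≡ 1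
  open-product-beyond μ c k k<c = trans
    (Π∈-cong (downFrom k) λ v v∈ → trans
      (cong (λ b → χ (not (μ v ∧ b))) (≢⇒≡ᵇ (<⇒≢ (≤-<-trans (∈-downFrom⁻ v∈) k<c))))
      (χ-not-∧-false (μ v)))
    (Π∈-one (downFrom k))

  open-product : ∀ (μ : ℕ → Bool) c k → c ≤ k →
    Π∈ (downFrom k) (λ v → χ (not (μ v ∧ (suc v ≡ᵇ c)))) ≡ χ (open-site μ c)
  open-product μ zero zero    _  = refl
  open-product μ c    (suc k) c≤ with c ≟ suc k
  ... | yes refl = trans
    (cong₂ _*_ (cong (λ b → χ (not (μ k ∧ b))) (≡ᵇ-refl k)) (open-product-beyond μ c k ≤-refl))
    (lem (μ k))
    where
    lem : ∀ b → χ (not (b ∧ true)) * 1 ≡ χ (not b)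
    lem true  = refl
    lem false = refl
  ... | no c≢sk = trans
    (cong₂ _*_
      (trans (cong (λ b → χ (not (μ k ∧ b))) (≢⇒≡ᵇ (≢-sym c≢sk))) (χ-not-∧-false (μ k)))
      (open-product μ c k (≤-pred (≤∧≢⇒< c≤ c≢sk))))
    (+-identityʳ _)

  module Marked (s d e : ℕ) {lt : ℕ → ℕ → Bool} (tree : Tree lt) where
    open Tree tree

    κ : ℕ → ℕ → ℕ
    κ p r = if lt p r then d else e

    open Paths s κ

    -- Expansion of factor (suc d) (suc e) into its two summands, the second of which
    -- vanishes on used values.
    mark-factor : Bool → Bool → Bool → ℕ
    mark-factor false _     _ = 1
    mark-factor true  true  _ = 0
    mark-factor true  false r = if r then d else e

    weight : (ℕ → Bool) → Vec ℕ (suc k) → ℕ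
    weight {k} μ a = s ^ zeros a * Π∈ (downFrom k) λ v → mark-factor (μ v) (mem (suc v) a) (rise a v)

    monomial-expand : (a : Vec ℕ (suc k)) →
      monomial s (suc d) (suc e) (stats a) ≡ Σ∈ (subsets k) λ μ → weight μ a
    monomial-expand {k} a = begin
      monomial s (suc d) (suc e) (stats a)
        ≡⟨ monomial-factor s (suc d) (suc e) (zeros a) (λ v → mem (suc v) a) (rise a) (downFrom k) ⟩
      s ^ zeros a * Π∈ (downFrom k) (λ v → factor (suc d) (suc e) (mem (suc v) a) (rise a v))
        ≡⟨ cong (s ^ zeros a *_) (Π∈-cong (downFrom k) λ v _ → binomial (mem (suc v) a) (rise a v)) ⟩
      s ^ zeros a * Π∈ (downFrom k) (λ v → mark-factor false (mem (suc v) a) (rise a v)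
                                           + mark-factor true (mem (suc v) a) (rise a v))
        ≡⟨ cong (s ^ zeros a *_) (Π-expand k λ v b → mark-factor b (mem (suc v) a) (rise a v)) ⟩
      s ^ zeros a * Σ∈ (subsets k) (λ μ → Π∈ (downFrom k) λ v → mark-factor (μ v) (mem (suc v) a) (rise a v))
        ≡⟨ Σ∈-* (subsets k) (s ^ zeros a) _ ⟨
      Σ∈ (subsets k) (λ μ → weight μ a) ∎
      where
      binomial : ∀ u r → factor (suc d) (suc e) u r ≡ mark-factor false u r + mark-factor true u r
      binomial true  _     = refl
      binomial false true  = refl
      binomial false false = refl

    module _ (μ : ℕ → Bool) where

      step : Vec ℕ (suc k) → ℕ → ℕ
      step {k} a c = if μ k then (if rises a c then d else e) else 1

      -- A new entry can only interfere with earlier marks by using a marked value; the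
      -- comparison with the previous entry belongs to the mark k.
      weight-child : (a : Vec ℕ (suc k)) (c : ℕ) → IsCode a → c ≤ suc k →
        weight μ (c ∷ a) ≡ weight μ a * (χ (open-site μ c) * (zeroWeight c * step a c))
      weight-child {k} a@(_ ∷ _) c ok c≤ = begin
        s ^ (χ (c ≡ᵇ 0) + zeros a) * (new * Π∈ (downFrom k) (λ v → mark-factor (μ v) (mem (suc v) (c ∷ a)) (rise (c ∷ a) v)))
          ≡⟨ cong₂ _*_ (zeros-factor c) (cong (new *_) (trans
               (Π∈-cong (downFrom k) λ v v∈ → old v (<⇒≢ (∈-downFrom⁻ v∈)))
               (Π∈-* (downFrom k) F δ))) ⟩
        (zeroWeight c * s ^ zeros a) * (new * (Π∈ (downFrom k) F * Π∈ (downFrom k) δ))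
          ≡⟨ shuffle (zeroWeight c) (s ^ zeros a) new (Π∈ (downFrom k) F) (Π∈ (downFrom k) δ) ⟩
        weight μ a * (zeroWeight c * (new * Π∈ (downFrom k) δ))
          ≡⟨ cong (λ z → weight μ a * (zeroWeight c * z)) final ⟩
        weight μ a * (zeroWeight c * (χ (open-site μ c) * step a c))
          ≡⟨ cong (weight μ a *_) (exchange (zeroWeight c) (χ (open-site μ c)) (step a c)) ⟩
        weight μ a * (χ (open-site μ c) * (zeroWeight c * step a c)) ∎
        where
        new : ℕ
        new = mark-factor (μ k) (mem (suc k) (c ∷ a)) (rise (c ∷ a) k)
        F δ : ℕ → ℕ
        F v = mark-factor (μ v) (mem (suc v) a) (rise a v)
        δ v = χ (not (μ v ∧ (suc v ≡ᵇ c)))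

        zeros-factor : ∀ c → s ^ (χ (c ≡ᵇ 0) + zeros a) ≡ zeroWeight c * s ^ zeros a
        zeros-factor zero    = refl
        zeros-factor (suc c) = sym (+-identityʳ _)

        shuffle : ∀ a z n f e → (a * z) * (n * (f * e)) ≡ (z * f) * (a * (n * e))
        shuffle = solve-∀
        exchange : ∀ a b c → a * (b * c) ≡ b * (a * c)
        exchange = solve-∀

        old : ∀ v → v ≢ k → mark-factor (μ v) (mem (suc v) (c ∷ a)) (rise (c ∷ a) v) ≡ F v * δ v
        old v v≢k rewrite ≢⇒≡ᵇ v≢k = lem (μ v) (suc v ≡ᵇ c) (mem (suc v) a) (rise a v)
          where
          lem : ∀ m b u r → mark-factor m (b ∨ u) r ≡ mark-factor m u r * χ (not (m ∧ b))
          lem false b     u     r = refl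
          lem true  true  u     r = sym (*-zeroʳ (mark-factor true u r))
          lem true  false u     r = sym (*-identityʳ (mark-factor true u r))

        new-step : suc k ≢ c → new ≡ step a c
        new-step k≢c rewrite ≢⇒≡ᵇ k≢c | mem-fresh a ok (suc k) ≤-refl | ≡ᵇ-refl k = lem (μ k) (rises a c)
          where
          lem : ∀ m r → mark-factor m false r ≡ (if m then (if r then d else e) else 1)
          lem true  r = refl
          lem false r = refl

        final : new * Π∈ (downFrom k) δ ≡ χ (open-site μ c) * step a c
        final with c ≟ suc k
        ... | no c≢sk = trans
          (cong₂ _*_ (new-step (≢-sym c≢sk)) (open-product μ c k (≤-pred (≤∧≢⇒< c≤ c≢sk))))
          (*-comm (step a c) _)
        ... | yes refl = trans
          (cong₂ _*_ (cong (λ b → mark-factor (μ k) (b ∨ mem (suc k) a) (rise (c ∷ a) k)) (≡ᵇ-refl k))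
                     (open-product-beyond μ c k ≤-refl))
          (lem (μ k) (rise (c ∷ a) k) (rises a c))
          where
          lem : ∀ m r r′ → mark-factor m true r * 1 ≡ χ (not m) * (if m then (if r′ then d else e) else 1)
          lem true  r r′ = refl
          lem false r r′ = refl

      weight-closed : (a : Vec ℕ (suc k)) → IsCode a → open-site μ (head a) ≡ false → weight μ a ≡ 0
      weight-closed {zero}  (zero ∷ []) _       ()
      weight-closed {suc k} (c ∷ a) (c≤ , ok) closed = begin
        weight μ (c ∷ a)                                         ≡⟨ weight-child a c ok c≤ ⟩
        weight μ a * (χ (open-site μ c) * (zeroWeight c * step a c))   ≡⟨ cong (λ b → weight μ a * (χ b * (zeroWeight c * step a c))) closed ⟩
        weight μ a * 0                                           ≡⟨ *-zeroʳ (weight μ a) ⟩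
        0                                                        ∎

      o : ℕ → Bool
      o = open-site μ

      opens : ℕ → ℕ
      opens k = Σ∈ (downFrom (suc k)) (χ ∘ o)

      pointer : Vec ℕ (suc k) → ℕ
      pointer a = rank o (head a) (sites a)

      transfer : ℕ → ℕ → ℕ → ℕ
      transfer k p r = zeroWeight r * (if μ k then κ p r else 1)

      opens-sites : (a : Vec ℕ n) → IsCode a → Σ∈ (sites a) (χ ∘ o) ≡ opens n
      opens-sites a ok = Σ∈-↭ (χ ∘ o) (sites-↭ a ok)

      sites-unique : (a : Vec ℕ n) → IsCode a → Unique (sites a)
      sites-unique {n} a ok = unique-resp-↭ (↭-sym (sites-↭ a ok)) (Unq.downFrom⁺ (suc n))

      zeroWeight-rank : ∀ c r → (c ≡ᵇ 0) ≡ (r ≡ᵇ 0) → zeroWeight c ≡ zeroWeight r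
      zeroWeight-rank zero    zero    _ = refl
      zeroWeight-rank (suc c) (suc r) _ = refl

      step-transfer : (a : Vec ℕ (suc k)) (c : ℕ) → IsCode a → c ≤ suc k → o (head a) ≡ true → o c ≡ true →
        zeroWeight c * step a c ≡ transfer k (pointer a) (rank o c (sites a))
      step-transfer {k} a c ok c≤ oh oc = cong₂ _*_ (zeroWeight-rank c (rank o c (sites a)) (rank-zero a c ok c≤ o refl oc)) (branch (μ k) refl)
        where
        branch : ∀ b → μ k ≡ b → step a c ≡ (if μ k then κ (pointer a) (rank o c (sites a)) else 1)
        branch false eq rewrite eq = refl
        branch true  eq rewrite eq = cong (λ b → if b then d else e)
          (rises-rank a c ok (≤-pred (≤∧≢⇒< c≤ c≢sk)) o oh oc)
          where
          c≢sk : c ≢ suc k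
          c≢sk c≡sk with () ← trans (sym oc) (trans (cong o c≡sk) (cong not eq))

      -- The unmarked values have every rank below their number exactly once, so the sum
      -- over the extensions of a code becomes a sum over ranks which depends on the code
      -- through the rank of its last entry alone.
      children : (a : Vec ℕ (suc k)) → IsCode a → (h : ℕ → ℕ) →
        Σ∈ (downFrom (suc (suc k))) (λ c → weight μ (c ∷ a) * h (rank o c (sites (c ∷ a))))
        ≡ weight μ a * Σ∈ (downFrom (opens (suc k))) (λ r → transfer k (pointer a) r * h r)
      children {k} a ok h with o (head a) in oh
      ... | false = begin
        Σ∈ (downFrom (suc (suc k))) (λ c → weight μ (c ∷ a) * h (rank o c (sites (c ∷ a))))
          ≡⟨ (Σ∈-cong (downFrom (suc (suc k))) λ c c∈ → cong (_* h (rank o c (sites (c ∷ a))))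
               (trans (weight-child a c ok (≤-pred (∈-downFrom⁻ c∈)))
                      (cong (_* (χ (o c) * (zeroWeight c * step a c))) (weight-closed a ok oh)))) ⟩
        Σ∈ (downFrom (suc (suc k))) (λ c → 0)
          ≡⟨ Σ∈-zero (downFrom (suc (suc k))) ⟩
        0
          ≡⟨ cong (_* Σ∈ (downFrom (opens (suc k))) (λ r → transfer k (pointer a) r * h r)) (weight-closed a ok oh) ⟨
        weight μ a * Σ∈ (downFrom (opens (suc k))) (λ r → transfer k (pointer a) r * h r) ∎
      ... | true = begin
        Σ∈ (downFrom (suc (suc k))) (λ c → weight μ (c ∷ a) * h (rank o c (sites (c ∷ a))))
          ≡⟨ (Σ∈-cong (downFrom (suc (suc k))) λ c c∈ → child c (≤-pred (∈-downFrom⁻ c∈))) ⟩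
        Σ∈ (downFrom (suc (suc k))) (λ c → weight μ a * (χ (o c) * g (rank o c (sites a))))
          ≡⟨ Σ∈-* (downFrom (suc (suc k))) (weight μ a) _ ⟩
        weight μ a * Σ∈ (downFrom (suc (suc k))) (λ c → χ (o c) * g (rank o c (sites a)))
          ≡⟨ cong (weight μ a *_) (Σ∈-↭ _ (sites-↭ a ok)) ⟨
        weight μ a * Σ∈ (sites a) (λ c → χ (o c) * g (rank o c (sites a)))
          ≡⟨ cong (weight μ a *_) (Σ-rank o (sites-unique a ok) g) ⟩
        weight μ a * Σ∈ (downFrom (Σ∈ (sites a) (χ ∘ o))) g
          ≡⟨ cong (λ j → weight μ a * Σ∈ (downFrom j) g) (opens-sites a ok) ⟩
        weight μ a * Σ∈ (downFrom (opens (suc k))) g ∎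
        where
        g : ℕ → ℕ
        g r = transfer k (pointer a) r * h r

        child : ∀ c → c ≤ suc k → weight μ (c ∷ a) * h (rank o c (sites (c ∷ a)))
                                ≡ weight μ a * (χ (o c) * g (rank o c (sites a)))
        child c c≤ rewrite rank-child a c ok c≤ o | weight-child a c ok c≤ = by-openness (o c) refl
          where
          H = h (rank o c (sites a))
          by-openness : ∀ b → o c ≡ b →
            weight μ a * (χ (o c) * (zeroWeight c * step a c)) * H ≡ weight μ a * (χ (o c) * g (rank o c (sites a)))
          by-openness false oc rewrite oc = *-assoc (weight μ a) 0 H
          by-openness true  oc rewrite oc | step-transfer a c ok c≤ oh oc =
            lem (weight μ a) (transfer k (pointer a) (rank o c (sites a))) H
            where
            lem : ∀ w t h → w * (1 * t) * h ≡ w * (1 * (t * h))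
            lem = solve-∀

      -- The number of marks in the current block, that is, directly below k.
      run : ℕ → ℕ
      run zero    = 0
      run (suc k) = if μ k then suc (run k) else 0

      -- The contribution of the completed blocks.  An unmarked value ends a block, since
      -- the comparison belonging to it is not weighted.
      blocks : ℕ → ℕ
      blocks zero    = 1
      blocks (suc k) = if μ k then blocks k else blocks k * total (opens k) (run k)

      -- Within a block, the ranks of the entries form a weighted path: so the last rank r
      -- is distributed like the endpoint of a path of length run k, independently of the
      -- completed blocks.  The function h tests this distribution.
      pointer-sum : ∀ k (h : ℕ → ℕ) →
        Σ∈ (codes (suc k)) (λ a → weight μ a * h (pointer a))
        ≡ blocks k * Σ∈ (downFrom (opens k)) (λ r → zeroWeight r * paths (opens k) (run k) r * h r)
      pointer-sum zero h = trans (cong (λ r → s * 1 * 1 * h r + 0) root-pointer) (lem s (h 0))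
        where
        root-pointer : pointer (0 ∷ []) ≡ 0
        root-pointer = trans (rank-child [] 0 tt z≤n o)
          (cong (rank o 0) (↭P.↭-singleton-inv (sites-↭ [] tt)))
        lem : ∀ s h → s * 1 * 1 * h + 0 ≡ 1 * (s * 1 * h + 0)
        lem = solve-∀
      pointer-sum (suc k) h = begin
        Σ∈ (codes (suc (suc k))) (λ a → weight μ a * h (pointer a))
          ≡⟨ Σ∈-codes (suc k) _ ⟩
        Σ∈ (codes (suc k)) (λ a → Σ∈ (downFrom (suc (suc k))) λ c → weight μ (c ∷ a) * h (rank o c (sites (c ∷ a))))
          ≡⟨ (Σ∈-cong (codes (suc k)) λ a a∈ → children a (∈-codes⁻ a a∈) h) ⟩
        Σ∈ (codes (suc k)) (λ a → weight μ a * h′ (pointer a))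
          ≡⟨ pointer-sum k h′ ⟩
        blocks k * Σ∈ (downFrom (opens k)) (λ p → zeroWeight p * paths (opens k) (run k) p * h′ p)
          ≡⟨ advance (μ k) refl ⟩
        blocks (suc k) * Σ∈ (downFrom (opens (suc k))) (λ r → zeroWeight r * paths (opens (suc k)) (run (suc k)) r * h r) ∎
        where
        h′ : ℕ → ℕ
        h′ p = Σ∈ (downFrom (opens (suc k))) (λ r → transfer k p r * h r)

        advance : ∀ b → μ k ≡ b →
          blocks k * Σ∈ (downFrom (opens k)) (λ p → zeroWeight p * paths (opens k) (run k) p * h′ p)
          ≡ blocks (suc k) * Σ∈ (downFrom (opens (suc k))) (λ r → zeroWeight r * paths (opens (suc k)) (run (suc k)) r * h r)
        advance true eq rewrite eq = cong (blocks k *_) (begin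
          Σ∈ js (λ p → A p * Σ∈ js (λ r → zeroWeight r * κ p r * h r))
            ≡⟨ (Σ∈-cong js λ p _ → sym (Σ∈-* js (A p) _)) ⟩
          Σ∈ js (λ p → Σ∈ js (λ r → A p * (zeroWeight r * κ p r * h r)))
            ≡⟨ Σ∈-swap js js _ ⟩
          Σ∈ js (λ r → Σ∈ js (λ p → A p * (zeroWeight r * κ p r * h r)))
            ≡⟨ (Σ∈-cong js λ r _ → trans
                 (Σ∈-cong js λ p _ → lem (A p) (zeroWeight r) (κ p r) (h r))
                 (trans (Σ∈-* js (zeroWeight r * h r) _) (lem′ (zeroWeight r) (h r) _))) ⟩
          Σ∈ js (λ r → zeroWeight r * paths (opens k) (suc (run k)) r * h r) ∎)
          where
          js = downFrom (opens k)
          A : ℕ → ℕ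
          A p = zeroWeight p * paths (opens k) (run k) p
          lem : ∀ a s κ h → a * (s * κ * h) ≡ (s * h) * (a * κ)
          lem = solve-∀
          lem′ : ∀ s h p → s * h * p ≡ s * p * h
          lem′ = solve-∀
        advance false eq rewrite eq = begin
          blocks k * Σ∈ (downFrom (opens k)) (λ p → A p * H)
            ≡⟨ cong (blocks k *_) (trans (Σ∈-cong (downFrom (opens k)) λ p _ → *-comm (A p) H)
                                         (Σ∈-* (downFrom (opens k)) H A)) ⟩
          blocks k * (H * total (opens k) (run k))
            ≡⟨ lem (blocks k) H (total (opens k) (run k)) ⟩
          blocks k * total (opens k) (run k) * H ∎
          where
          A : ℕ → ℕ
          A p = zeroWeight p * paths (opens k) (run k) p
          H = Σ∈ (downFrom (suc (opens k))) (λ r → zeroWeight r * 1 * h r)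
          lem : ∀ b h t → b * (h * t) ≡ b * t * h
          lem = solve-∀

      weight-sum : ∀ k → Σ∈ (codes (suc k)) (weight μ) ≡ blocks k * total (opens k) (run k)
      weight-sum k = begin
        Σ∈ (codes (suc k)) (weight μ)
          ≡⟨ (Σ∈-cong (codes (suc k)) λ a _ → *-identityʳ (weight μ a)) ⟨
        Σ∈ (codes (suc k)) (λ a → weight μ a * 1)
          ≡⟨ pointer-sum k (λ _ → 1) ⟩
        blocks k * Σ∈ (downFrom (opens k)) (λ r → zeroWeight r * paths (opens k) (run k) r * 1)
          ≡⟨ cong (blocks k *_) (Σ∈-cong (downFrom (opens k)) λ r _ → *-identityʳ _) ⟩
        blocks k * total (opens k) (run k) ∎

  module _ {lt : ℕ → ℕ → Bool} (tree : Tree lt) (tree′ : Tree (λ p r → lt r p)) where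
    private
      module S = Tree tree
      module S′ = Tree tree′

    -- Each choice of marks contributes a product of totals of paths, and these do not
    -- change when the comparison is reversed.
    stats-sum : ∀ s d e k →
      Σ∈ (codes (suc k)) (monomial s (suc d) (suc e) ∘ S.stats)
      ≡ Σ∈ (codes (suc k)) (monomial s (suc d) (suc e) ∘ S′.stats)
    stats-sum s d e k = begin
      Σ∈ (codes (suc k)) (monomial s (suc d) (suc e) ∘ S.stats)
        ≡⟨ (Σ∈-cong (codes (suc k)) λ a _ → M.monomial-expand a) ⟩
      Σ∈ (codes (suc k)) (λ a → Σ∈ (subsets k) λ μ → M.weight μ a)
        ≡⟨ Σ∈-swap (codes (suc k)) (subsets k) _ ⟩
      Σ∈ (subsets k) (λ μ → Σ∈ (codes (suc k)) (M.weight μ))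
        ≡⟨ (Σ∈-cong (subsets k) λ μ _ → trans (M.weight-sum μ k)
              (trans (cong₂ _*_ (blocks-eq μ k) (total-eq (M.opens μ k) (run-eq μ k)))
                     (sym (M′.weight-sum μ k)))) ⟩
      Σ∈ (subsets k) (λ μ → Σ∈ (codes (suc k)) (M′.weight μ))
        ≡⟨ Σ∈-swap (codes (suc k)) (subsets k) _ ⟨
      Σ∈ (codes (suc k)) (λ a → Σ∈ (subsets k) λ μ → M′.weight μ a)
        ≡⟨ (Σ∈-cong (codes (suc k)) λ a _ → M′.monomial-expand a) ⟨
      Σ∈ (codes (suc k)) (monomial s (suc d) (suc e) ∘ S′.stats) ∎
      where
      module M  = Marked s d e tree
      module M′ = Marked s d e tree′
      module T  = Paths s M.κ
      module T′ = Paths s M′.κ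

      run-eq : ∀ μ k → M.run μ k ≡ M′.run μ k
      run-eq μ zero    = refl
      run-eq μ (suc k) = cong (λ r → if μ k then suc r else 0) (run-eq μ k)

      total-eq : ∀ j {l l′} → l ≡ l′ → T.total j l ≡ T′.total j l′
      total-eq j {l} refl = total-transpose s M.κ j l

      blocks-eq : ∀ μ k → M.blocks μ k ≡ M′.blocks μ k
      blocks-eq μ zero    = refl
      blocks-eq μ (suc k) = cong₂ (λ b t → if μ k then b else b * t) (blocks-eq μ k)
                              (total-eq (M.opens μ k) (run-eq μ k))

    stats-↭ : ∀ k → map (S.stats {k}) (codes (suc k)) ↭ map (S′.stats {k}) (codes (suc k))
    stats-↭ k = monomial-sums⇒↭ (codes (suc k)) S.stats S′.stats λ { s (suc d) (suc e) _ _ _ → stats-sum s d e k }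

open Trees

-- The usual order of values
module NumericalTree where
  open ≡-Reasoning

  -- To the right of c are the values below c.
  rank-downFrom : ∀ o {c} m → c < m → rank o c (downFrom m) ≡ Σ∈ (downFrom c) (χ ∘ o)
  rank-downFrom o {c} (suc m) c<sm with c ≟ m
  ... | yes refl = rank-here o c (downFrom c)
  ... | no c≢m   = trans (rank-there o (downFrom m) c≢m) (rank-downFrom o m (≤∧≢⇒< (≤-pred c<sm) c≢m))

  count-mono-≤ : ∀ (o : ℕ → Bool) {c p} → c ≤ p → Σ∈ (downFrom c) (χ ∘ o) ≤ Σ∈ (downFrom p) (χ ∘ o)
  count-mono-≤ o {p = zero} z≤n = ≤-refl
  count-mono-≤ o {c} {suc p} c≤ with c ≟ suc p
  ... | yes refl = ≤-refl
  ... | no c≢    = ≤-trans (count-mono-≤ o (≤-pred (≤∧≢⇒< c≤ c≢))) (m≤n+m _ (χ (o p)))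

  count-mono-< : ∀ (o : ℕ → Bool) {c p} → o c ≡ true → c < p → Σ∈ (downFrom c) (χ ∘ o) < Σ∈ (downFrom p) (χ ∘ o)
  count-mono-< o {c} {p} oc c<p = ≤-trans
    (≤-reflexive (cong (λ b → χ b + Σ∈ (downFrom c) (χ ∘ o)) (sym oc)))
    (count-mono-≤ o c<p)

  head-≤ : (a : Vec ℕ (suc k)) → IsCode a → head a ≤ k
  head-≤ (c ∷ a) (c≤ , _) = c≤

  numericalTree : Tree (λ p r → r <ᵇ p)
  numericalTree = record
    { sites      = λ {n} _ → downFrom (suc n)
    ; rises      = λ a c → c <ᵇ head a
    ; sites-↭    = λ _ _ → ↭-refl
    ; rank-child = λ {n} a c _ c≤n o → rank-there o (downFrom (suc n)) (<⇒≢ (s≤s c≤n))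
    ; rank-zero  = λ {n} a c _ c≤n o o0 oc → trans (zero-count c o o0)
                     (cong (_≡ᵇ 0) (sym (rank-downFrom o (suc n) (s≤s c≤n))))
    ; rises-rank = λ {k} a c ok c≤k o oh oc → trans (compare o c (head a) oc)
                     (sym (cong₂ _<ᵇ_ (rank-downFrom o (suc (suc k)) (s≤s (m≤n⇒m≤1+n c≤k)))
                                      (rank-downFrom o (suc (suc k)) (s≤s (m≤n⇒m≤1+n (head-≤ a ok))))))
    }
    where
    zero-count : ∀ c o → o 0 ≡ true → (c ≡ᵇ 0) ≡ (Σ∈ (downFrom c) (χ ∘ o) ≡ᵇ 0)
    zero-count zero    o o0 = refl
    zero-count (suc c) o o0 = sym (≢⇒≡ᵇ (≢-sym (<⇒≢ (count-mono-< o o0 (s≤s z≤n)))))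

    compare : ∀ o c p → o c ≡ true →
              (c <ᵇ p) ≡ (Σ∈ (downFrom c) (χ ∘ o) <ᵇ Σ∈ (downFrom p) (χ ∘ o))
    compare o c p oc with c <? p
    ... | yes c<p = trans (<⇒<ᵇ≡true c<p) (sym (<⇒<ᵇ≡true (count-mono-< o oc c<p)))
    ... | no c≮p  = trans (≥⇒<ᵇ≡false (≮⇒≥ c≮p)) (sym (≥⇒<ᵇ≡false (count-mono-≤ o (≮⇒≥ c≮p))))

open NumericalTree

-- The order of values in a growing permutation
module InsertionTree where
  open ≡-Reasoning

  insertBefore : ℕ → ℕ → List ℕ → List ℕ
  insertBefore x c []       = x ∷ []
  insertBefore x c (y ∷ ys) = if c ≡ᵇ y then x ∷ y ∷ ys else y ∷ insertBefore x c ys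

  insertBefore-here : ∀ x c ys → insertBefore x c (c ∷ ys) ≡ x ∷ c ∷ ys
  insertBefore-here x c ys = cong (λ b → if b then x ∷ c ∷ ys else c ∷ insertBefore x c ys) (≡ᵇ-refl c)

  insertBefore-there : ∀ x {c y} ys → c ≢ y → insertBefore x c (y ∷ ys) ≡ y ∷ insertBefore x c ys
  insertBefore-there x {c} {y} ys c≢y = cong (λ b → if b then x ∷ y ∷ ys else y ∷ insertBefore x c ys) (≢⇒≡ᵇ c≢y)

  insertBefore-↭ : ∀ x c ys → insertBefore x c ys ↭ x ∷ ys
  insertBefore-↭ x c []       = ↭-refl
  insertBefore-↭ x c (y ∷ ys) with c ≡ᵇ y
  ... | true  = ↭-refl
  ... | false = ↭-trans (Perm.prep y (insertBefore-↭ x c ys)) (Perm.swap y x ↭-refl)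

  rank-insertBefore : ∀ o {x c} ys → c ≢ x → rank o c (insertBefore x c ys) ≡ rank o c ys
  rank-insertBefore o {x} {c} []       c≢x = rank-there o [] c≢x
  rank-insertBefore o {x} {c} (y ∷ ys) c≢x with c ≟ y
  ... | yes refl = trans (cong (rank o c) (insertBefore-here x c ys)) (rank-there o (c ∷ ys) c≢x)
  ... | no c≢y   = begin
    rank o c (insertBefore x c (y ∷ ys)) ≡⟨ cong (rank o c) (insertBefore-there x ys c≢y) ⟩
    rank o c (y ∷ insertBefore x c ys)   ≡⟨ rank-there o (insertBefore x c ys) c≢y ⟩
    rank o c (insertBefore x c ys)       ≡⟨ rank-insertBefore o ys c≢x ⟩
    rank o c ys                          ≡⟨ rank-there o ys c≢y ⟨
    rank o c (y ∷ ys)                    ∎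

  EndsInZero : List ℕ → Set
  EndsInZero ys = ∃[ xs ] ys ≡ xs ++ 0 ∷ [] × All (0 <_) xs

  insertBefore-endsInZero : ∀ x c ys → 0 < x → c ∈ ys → EndsInZero ys → EndsInZero (insertBefore x c ys)
  insertBefore-endsInZero x c _ 0<x (here refl) ([] , refl , []) = x ∷ [] , insertBefore-here x c [] , 0<x ∷ []
  insertBefore-endsInZero x c _ 0<x (there ()) ([] , refl , [])
  insertBefore-endsInZero x c _ 0<x c∈ (y ∷ xs , refl , 0<y ∷ 0<xs) with c ≟ y
  ... | yes refl = x ∷ y ∷ xs , insertBefore-here x c _ , 0<x ∷ 0<y ∷ 0<xs
  ... | no c≢y with c∈
  ...   | here c≡y = ⊥-elim (c≢y c≡y)
  ...   | there c∈′ with xs′ , eq , 0<xs′ ← insertBefore-endsInZero x c _ 0<x c∈′ (xs , refl , 0<xs)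
        = y ∷ xs′ , trans (insertBefore-there x _ c≢y) (cong (y ∷_) eq) , 0<y ∷ 0<xs′

  rank-zero-last : ∀ o {ys} → EndsInZero ys → rank o 0 ys ≡ 0
  rank-zero-last o ([]     , refl , [])         = refl
  rank-zero-last o (y ∷ xs , refl , 0<y ∷ 0<xs) =
    trans (rank-there o (xs ++ 0 ∷ []) (<⇒≢ 0<y)) (rank-zero-last o (xs , refl , 0<xs))

  rank-before-last : ∀ o {c ys} → EndsInZero ys → c ∈ ys → c ≢ 0 → o 0 ≡ true → 0 < rank o c ys
  rank-before-last o ([] , refl , []) (here c≡0) c≢0 _ = ⊥-elim (c≢0 c≡0)
  rank-before-last o ([] , refl , []) (there ())
  rank-before-last o {c} (y ∷ xs , refl , 0<y ∷ 0<xs) c∈ c≢0 o0 with c ≟ y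
  ... | yes refl = subst (0 <_) (sym (rank-here o c (xs ++ 0 ∷ [])))
                     (≤-trans (s≤s z≤n) (rank-< o (xs ++ 0 ∷ []) (∈-++⁺ʳ xs (here refl)) o0))
  ... | no c≢y with c∈
  ...   | here c≡y  = ⊥-elim (c≢y c≡y)
  ...   | there c∈′ = subst (0 <_) (sym (rank-there o (xs ++ 0 ∷ []) c≢y))
                        (rank-before-last o (xs , refl , 0<xs) c∈′ c≢0 o0)

  -- False unless x occurs.
  precedes : ℕ → ℕ → List ℕ → Bool
  precedes x y []       = false
  precedes x y (z ∷ zs) = not (y ≡ᵇ z) ∧ ((x ≡ᵇ z) ∨ precedes x y zs)

  precedes-insertBefore : ∀ {x y u} c zs → x ≢ u → y ≢ u → precedes x y (insertBefore u c zs) ≡ precedes x y zs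
  precedes-insertBefore {x} {y} {u} c [] x≢u y≢u rewrite ≢⇒≡ᵇ y≢u | ≢⇒≡ᵇ x≢u = refl
  precedes-insertBefore {x} {y} {u} c (z ∷ zs) x≢u y≢u with c ≡ᵇ z
  ... | true  rewrite ≢⇒≡ᵇ y≢u | ≢⇒≡ᵇ x≢u = refl
  ... | false = cong (λ b → not (y ≡ᵇ z) ∧ ((x ≡ᵇ z) ∨ b)) (precedes-insertBefore c zs x≢u y≢u)

  -- Since x stands directly to the left of p, an element c other than x is to the left
  -- of x if and only if it is to the left of p, and u is placed next to c.
  precedes-rank : ∀ o {x p c u} zs → p ∈ zs → c ∈ zs → x ∉ zs → u ∉ zs → x ≢ u → o p ≡ true →
    precedes u x (insertBefore u c (insertBefore x p zs))
    ≡ (rank o p (insertBefore x p zs) <ᵇ rank o c (insertBefore x p zs))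
  precedes-rank o {x} {p} {c} {u} (z ∷ zs) p∈ c∈ x∉ u∉ x≢u op with p ≟ z
  ... | yes refl rewrite insertBefore-here x p zs
          | insertBefore-there u {c} {x} (p ∷ zs) (λ { refl → x∉ c∈ })
          | ≡ᵇ-refl x
          | rank-there o {p} {x} (p ∷ zs) (λ { refl → x∉ p∈ })
          | rank-there o {c} {x} (p ∷ zs) (λ { refl → x∉ c∈ })
          | rank-here o p zs
          = sym (≥⇒<ᵇ≡false at-most)
    where
    at-most : rank o c (p ∷ zs) ≤ Σ∈ zs (χ ∘ o)
    at-most with c ≟ p
    ... | yes refl = ≤-reflexive (rank-here o c zs)
    ... | no c≢p   = ≤-trans (≤-reflexive (rank-there o zs c≢p)) (rank-≤ o c zs)
  ... | no p≢z rewrite insertBefore-there x zs p≢z with c ≟ z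
  ...   | yes refl rewrite insertBefore-here u c (insertBefore x p zs)
          | ≢⇒≡ᵇ x≢u | ≡ᵇ-refl u
          | rank-here o c (insertBefore x p zs)
          | rank-there o (insertBefore x p zs) p≢z
          = sym (<⇒<ᵇ≡true (rank-< o (insertBefore x p zs)
              (↭P.∈-resp-↭ (↭-sym (insertBefore-↭ x p zs)) (there (Any.tail p≢z p∈))) op))
  ...   | no c≢z rewrite insertBefore-there u (insertBefore x p zs) c≢z
          | ≢⇒≡ᵇ {x} {z} (λ { refl → x∉ (here refl) })
          | ≢⇒≡ᵇ {u} {z} (λ { refl → u∉ (here refl) })
          | rank-there o (insertBefore x p zs) p≢z
          | rank-there o (insertBefore x p zs) c≢z
          = precedes-rank o zs (Any.tail p≢z p∈) (Any.tail c≢z c∈) (x∉ ∘ there) (u∉ ∘ there) x≢u op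

  -- Word of a permutation of 1, …, n followed by 0.
  arrange : Vec ℕ n → List ℕ
  arrange []               = 0 ∷ []
  arrange {suc n} (c ∷ as) = insertBefore (suc n) c (arrange as)

  arrange-↭ : (a : Vec ℕ n) → arrange a ↭ downFrom (suc n)
  arrange-↭ []               = ↭-refl
  arrange-↭ {suc n} (c ∷ as) = ↭-trans (insertBefore-↭ (suc n) c (arrange as)) (Perm.prep (suc n) (arrange-↭ as))

  ∈-arrange⁺ : (a : Vec ℕ n) → ∀ {c} → c ≤ n → c ∈ arrange a
  ∈-arrange⁺ a c≤n = ↭P.∈-resp-↭ (↭-sym (arrange-↭ a)) (∈-downFrom⁺ (s≤s c≤n))

  ∈-arrange⁻ : (a : Vec ℕ n) → ∀ {c} → c ∈ arrange a → c ≤ n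
  ∈-arrange⁻ a c∈ = ≤-pred (∈-downFrom⁻ (↭P.∈-resp-↭ (arrange-↭ a) c∈))

  arrange-endsInZero : (a : Vec ℕ n) → IsCode a → EndsInZero (arrange a)
  arrange-endsInZero []               _          = [] , refl , []
  arrange-endsInZero {suc n} (c ∷ as) (c≤n , ok) =
    insertBefore-endsInZero (suc n) c _ (s≤s z≤n) (∈-arrange⁺ as c≤n) (arrange-endsInZero as ok)

  insertionTree : Tree _<ᵇ_
  insertionTree = record
    { sites      = arrange
    ; rises      = λ {k} a c → precedes (suc (suc k)) (suc k) (arrange (c ∷ a))
    ; sites-↭    = λ a _ → arrange-↭ a
    ; rank-child = λ a c _ c≤n o → rank-insertBefore o (arrange a) (<⇒≢ (s≤s c≤n))
    ; rank-zero  = zero-last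
    ; rises-rank = λ { {k} (p ∷ a) c (p≤k , _) c≤k o oh oc → precedes-rank o (arrange a)
        (∈-arrange⁺ a p≤k) (∈-arrange⁺ a c≤k)
        (λ x∈ → 1+n≰n (∈-arrange⁻ a x∈)) (λ u∈ → 1+n≰n (≤-trans (n≤1+n _) (∈-arrange⁻ a u∈)))
        (<⇒≢ ≤-refl) oh }
    }
    where
    zero-last : ∀ {n} (a : Vec ℕ n) c → IsCode a → c ≤ n → ∀ o → o 0 ≡ true → o c ≡ true →
                (c ≡ᵇ 0) ≡ (rank o c (arrange a) ≡ᵇ 0)
    zero-last a zero    ok _   o _  _ = cong (_≡ᵇ 0) (sym (rank-zero-last o (arrange-endsInZero a ok)))
    zero-last a (suc c) ok c≤n o o0 _ = sym (≢⇒≡ᵇ (≢-sym (<⇒≢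
      (rank-before-last o (arrange-endsInZero a ok) (∈-arrange⁺ a c≤n) (λ ()) o0))))

open InsertionTree

-- Counting elements of a finite set
module Counting where
  does-≡ : {P : Set ℓ₁} (P? : Dec P) {b : Bool} → (P → b ≡ true) → (b ≡ true → P) → does P? ≡ b
  does-≡ (yes p) to from = sym (to p)
  does-≡ (no ¬p) {false} to from = refl
  does-≡ (no ¬p) {true}  to from = contradiction (from refl) ¬p

  does⇒ : {P : Set ℓ₁} (P? : Dec P) → does P? ≡ true → P
  does⇒ (yes p) _ = p

  cnt : (Fin n → Bool) → ℕ
  cnt {zero}  b = 0
  cnt {suc n} b = χ (b zero) + cnt (b ∘ suc)

  #≡cnt : ∀ {p} {P : Pred (Fin n) p} (P? : Decidable P) → # P? ≡ cnt (does ∘ P?)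
  #≡cnt {n} P? = go id
    where
    go : ∀ {m} (f : Fin m → Fin n) → Vec.count P? (tabulate f) ≡ cnt (does ∘ P? ∘ f)
    go {zero}  f = refl
    go {suc m} f with does (P? (f zero))
    ... | true  = cong suc (go (f ∘ suc))
    ... | false = go (f ∘ suc)

  cnt-cong : (b b′ : Fin n → Bool) → (∀ i → b i ≡ b′ i) → cnt b ≡ cnt b′
  cnt-cong {zero}  b b′ eq = refl
  cnt-cong {suc n} b b′ eq = cong₂ _+_ (cong χ (eq zero)) (cnt-cong (b ∘ suc) (b′ ∘ suc) (eq ∘ suc))

  cnt-last : (b : Fin (suc n) → Bool) → cnt b ≡ χ (b (fromℕ n)) + cnt (b ∘ inject₁)
  cnt-last {zero}  b = refl
  cnt-last {suc n} b = trans (cong (χ (b zero) +_) (cnt-last (b ∘ suc)))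
    (lem (χ (b zero)) (χ (b (fromℕ (suc n)))) (cnt (b ∘ suc ∘ inject₁)))
    where
    lem : ∀ x y z → x + (y + z) ≡ y + (x + z)
    lem = solve-∀

  cnt-downFrom : ∀ n {b : Fin n → Bool} (b′ : ℕ → Bool) → (∀ i → b i ≡ b′ (toℕ i)) →
                 cnt b ≡ Σ∈ (downFrom n) (χ ∘ b′)
  cnt-downFrom zero    b′ eq = refl
  cnt-downFrom (suc n) {b} b′ eq = trans (cnt-last b) (cong₂ _+_
    (cong χ (trans (eq (fromℕ n)) (cong b′ (FinP.toℕ-fromℕ n))))
    (cnt-downFrom n b′ λ i → trans (eq (inject₁ i)) (cong b′ (FinP.toℕ-inject₁ i))))

  χ-mono : ∀ {x y} → (x ≡ true → y ≡ true) → χ x ≤ χ y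
  χ-mono {false} _ = z≤n
  χ-mono {true}  h = ≤-reflexive (cong χ (sym (h refl)))

  cnt-mono : (b b′ : Fin n → Bool) → (∀ i → b i ≡ true → b′ i ≡ true) → cnt b ≤ cnt b′
  cnt-mono {zero}  b b′ h = z≤n
  cnt-mono {suc n} b b′ h = +-mono-≤ (χ-mono (h zero)) (cnt-mono (b ∘ suc) (b′ ∘ suc) (h ∘ suc))

  cnt-strict : (b b′ : Fin n → Bool) → (∀ i → b i ≡ true → b′ i ≡ true) →
               ∀ i → b i ≡ false → b′ i ≡ true → cnt b < cnt b′
  cnt-strict b b′ h zero    bi b′i rewrite bi | b′i = s≤s (cnt-mono (b ∘ suc) (b′ ∘ suc) (h ∘ suc))
  cnt-strict b b′ h (suc i) bi b′i = +-mono-≤-< (χ-mono (h zero)) (cnt-strict (b ∘ suc) (b′ ∘ suc) (h ∘ suc) i bi b′i)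

  cnt-true : ∀ n → cnt {n} (λ _ → true) ≡ n
  cnt-true zero    = refl
  cnt-true (suc n) = cong suc (cnt-true n)

  cnt-false : ∀ {n} {b : Fin n → Bool} → (∀ i → b i ≡ false) → cnt b ≡ 0
  cnt-false {zero}  eq = refl
  cnt-false {suc n} eq rewrite eq zero = cnt-false (eq ∘ suc)

  cnt-≤ : (b : Fin n → Bool) → cnt b ≤ n
  cnt-≤ {n} b = ≤-trans (cnt-mono b (λ _ → true) λ _ _ → refl) (≤-reflexive (cnt-true n))

  cnt-<ᵇ : ∀ {m n} → m ≤ n → cnt {n} (λ i → toℕ i <ᵇ m) ≡ m
  cnt-<ᵇ {n = n} z≤n = cnt-false {n} λ _ → refl
  cnt-<ᵇ (s≤s m≤n)   = cong suc (cnt-<ᵇ m≤n)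

  initial-segment : (b : Fin n → Bool) → (∀ i j → i Fin.< j → b j ≡ true → b i ≡ true) →
                    ∀ i → b i ≡ (toℕ i <ᵇ cnt b)
  initial-segment {suc n} b down i with b zero in b0
  initial-segment {suc n} b down zero    | true = b0
  initial-segment {suc n} b down (suc i) | true =
    initial-segment (b ∘ suc) (λ i j i<j → down (suc i) (suc j) (s≤s i<j)) i
  ... | false = trans (all-false i) (sym (cong (toℕ i <ᵇ_) (cnt-false (all-false ∘ suc))))
    where
    all-false : ∀ i → b i ≡ false
    all-false zero    = b0
    all-false (suc i) with b (suc i) in bi
    ... | false = refl
    ... | true  with () ← trans (sym b0) (down zero (suc i) (s≤s z≤n) bi)

open Counting

-- Codes as functions on positions
module CodesAsFunctions where
  open ≡-Reasoning

  fromFun : (Fin n → ℕ) → Vec ℕ n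
  fromFun {zero}  f = []
  fromFun {suc n} f = f (fromℕ n) ∷ fromFun (f ∘ inject₁)

  -- Entries numbered from the start of the sequence, that is, from the end of the
  -- vector; the value outside the sequence is arbitrary.
  at : Vec ℕ n → ℕ → ℕ
  at []               i = 0
  at {suc n} (c ∷ as) i = if i ≡ᵇ n then c else at as i

  at-last : ∀ (c : ℕ) (as : Vec ℕ n) → at (c ∷ as) n ≡ c
  at-last {n} c as = cong (λ b → if b then c else at as n) (≡ᵇ-refl n)

  at-earlier : ∀ (c : ℕ) (as : Vec ℕ n) {i} → i < n → at (c ∷ as) i ≡ at as i
  at-earlier c as {i} i<n = cong (λ b → if b then c else at as i) (≢⇒≡ᵇ (<⇒≢ i<n))

  at-fromFun : (f : Fin n → ℕ) (i : Fin n) → at (fromFun f) (toℕ i) ≡ f i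
  at-fromFun {suc n} f i with view i
  ... | ‵fromℕ     = trans (cong (at (fromFun f)) (FinP.toℕ-fromℕ n)) (at-last (f (fromℕ n)) (fromFun (f ∘ inject₁)))
  ... | ‵inject₁ j = begin
    at (fromFun f) (toℕ (inject₁ j))     ≡⟨ cong (at (fromFun f)) (FinP.toℕ-inject₁ j) ⟩
    at (fromFun f) (toℕ j)               ≡⟨ at-earlier (f (fromℕ n)) (fromFun (f ∘ inject₁)) (FinP.toℕ<n j) ⟩
    at (fromFun (f ∘ inject₁)) (toℕ j)   ≡⟨ at-fromFun (f ∘ inject₁) j ⟩
    f (inject₁ j)                        ∎

  fromFun-cong : {f g : Fin n → ℕ} → (∀ i → f i ≡ g i) → fromFun f ≡ fromFun g
  fromFun-cong {zero}  eq = refl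
  fromFun-cong {suc n} eq = cong₂ _∷_ (eq (fromℕ n)) (fromFun-cong (eq ∘ inject₁))

  fromFun-at : (a : Vec ℕ n) → fromFun (at a ∘ toℕ) ≡ a
  fromFun-at []               = refl
  fromFun-at {suc n} (c ∷ as) = cong₂ _∷_
    (trans (cong (at (c ∷ as)) (FinP.toℕ-fromℕ n)) (at-last c as))
    (trans (fromFun-cong λ i → trans (cong (at (c ∷ as)) (FinP.toℕ-inject₁ i)) (at-earlier c as (FinP.toℕ<n i)))
           (fromFun-at as))

  fromFun-isCode : (f : Fin n → ℕ) → (∀ i → f i ≤ toℕ i) → IsCode (fromFun f)
  fromFun-isCode {zero}  f h = tt
  fromFun-isCode {suc n} f h = ≤-trans (h (fromℕ n)) (≤-reflexive (FinP.toℕ-fromℕ n))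
    , fromFun-isCode (f ∘ inject₁) λ i → ≤-trans (h (inject₁ i)) (≤-reflexive (FinP.toℕ-inject₁ i))

  isCode-at : (a : Vec ℕ n) → IsCode a → ∀ i → i < n → at a i ≤ i
  isCode-at {suc n} (c ∷ as) (c≤n , ok) i i<sn with i ≟ n
  ... | yes refl = ≤-trans (≤-reflexive (at-last c as)) c≤n
  ... | no i≢n   = ≤-trans (≤-reflexive (at-earlier c as i<n)) (isCode-at as ok i i<n)
    where i<n = ≤∧≢⇒< (≤-pred i<sn) i≢n

  zeros-fromFun : (f : Fin n → ℕ) → zeros (fromFun f) ≡ cnt (λ i → f i ≡ᵇ 0)
  zeros-fromFun {zero}  f = refl
  zeros-fromFun {suc n} f = trans (cong (χ (f (fromℕ n) ≡ᵇ 0) +_) (zeros-fromFun (f ∘ inject₁)))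
                                  (sym (cnt-last (λ i → f i ≡ᵇ 0)))

  mem-fromFun⁺ : (f : Fin n → ℕ) (i : Fin n) → mem (f i) (fromFun f) ≡ true
  mem-fromFun⁺ {suc n} f i with view i
  ... | ‵fromℕ     rewrite ≡ᵇ-refl (f (fromℕ n)) = refl
  ... | ‵inject₁ j rewrite mem-fromFun⁺ (f ∘ inject₁) j = ∨-zeroʳ _

  mem-fromFun⁻ : (f : Fin n → ℕ) (v : ℕ) → mem v (fromFun f) ≡ true → ∃[ i ] f i ≡ v
  mem-fromFun⁻ {suc n} f v v∈ with v ≟ f (fromℕ n)
  ... | yes eq = fromℕ n , sym eq
  ... | no neq rewrite ≢⇒≡ᵇ neq with i , eq ← mem-fromFun⁻ (f ∘ inject₁) v v∈ = inject₁ i , eq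

  numerical-rise : (a : Vec ℕ (suc k)) → ∀ {v} → v < k →
                   Tree.rise numericalTree a v ≡ (at a (suc v) <ᵇ at a v)
  numerical-rise {suc k} (c ∷ as@(p ∷ as′)) {v} v<sk with v ≟ k
  ... | yes refl rewrite ≡ᵇ-refl v | ≢⇒≡ᵇ {v} {suc v} (<⇒≢ ≤-refl) = refl
  ... | no v≢k   = begin
    (if v ≡ᵇ k then c <ᵇ p else Tree.rise numericalTree as v)
      ≡⟨ cong (λ b → if b then c <ᵇ p else Tree.rise numericalTree as v) (≢⇒≡ᵇ v≢k) ⟩
    Tree.rise numericalTree as v
      ≡⟨ numerical-rise as v<k ⟩
    (at as (suc v) <ᵇ at as v)
      ≡⟨ cong₂ _<ᵇ_ (at-earlier c as (s≤s v<k)) (at-earlier c as (m≤n⇒m≤1+n v<k)) ⟨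
    (at (c ∷ as) (suc v) <ᵇ at (c ∷ as) v) ∎
    where v<k = ≤∧≢⇒< (≤-pred v<sk) v≢k

open CodesAsFunctions

-- Bijections between lists
module Bijections where
  private variable
    A : Set ℓ₁
    B : Set ℓ₂

  map-unique : ∀ (f : A → B) {xs} → (∀ {x y} → x ∈ xs → y ∈ xs → f x ≡ f y → x ≡ y) →
               Unique xs → Unique (map f xs)
  map-unique f {[]}     inj []             = []
  map-unique f {x ∷ xs} inj (x∉xs ∷ uniq) =
    All.tabulate (λ fy∈ fx≡ → let y , y∈ , eq = ∈-map⁻ f fy∈ in
      All.lookup x∉xs y∈ (inj (here refl) (there y∈) (trans fx≡ eq)))
    ∷ map-unique f (λ x∈ y∈ → inj (there x∈) (there y∈)) uniq

  unique-↭ : {xs ys : List A} → Unique xs → Unique ys →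
             (∀ {x} → x ∈ xs → x ∈ ys) → (∀ {x} → x ∈ ys → x ∈ xs) → xs ↭ ys
  unique-↭ ux uy to from = ∼bag⇒↭ (unique∧set⇒bag ux uy (mk⇔ to from))

  vectors-unique : {xs : List A} → Unique xs → ∀ k → Unique (vectors xs k)
  vectors-unique u zero    = [] ∷ []
  vectors-unique u (suc k) = Unq.cartesianProductWith⁺ _∷_ (λ { refl → refl , refl }) u (vectors-unique u k)

  ∈-vectors : {xs : List A} → (∀ x → x ∈ xs) → (v : Vec A k) → v ∈ vectors xs k
  ∈-vectors all []      = here refl
  ∈-vectors all (x ∷ v) = ∈-cartesianProductWith⁺ _∷_ (all x) (∈-vectors all v)

  injective⇒surjective : (f : Fin n → Fin n) → Injective _≡_ _≡_ f → ∀ q → ∃[ i ] f i ≡ q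
  injective⇒surjective {suc n} f inj q with FinP.any? (λ i → f i FinP.≟ q)
  ... | yes hit = hit
  ... | no miss = contradiction (FinP.injective⇒≤ {f = λ i → punchOut (miss′ i)}
                    λ eq → inj (FinP.punchOut-injective (miss′ _) (miss′ _) eq)) 1+n≰n
    where
    miss′ : ∀ i → q ≢ f i
    miss′ i eq = miss (i , sym eq)

open Bijections

-- The matching with a given code
module CodeToMatching where
  open import Data.Nat using (_*_)

  Event : ℕ → Set
  Event n = Fin n ⊎ Fin n

  pattern opener i = inj₁ i
  pattern closer i = inj₂ i

  n+n≡2*n : ∀ n → n + n ≡ 2 * n
  n+n≡2*n n = cong (n +_) (sym (+-identityʳ n))

  toEvent : ∀ n → Fin (2 * n) → Event n
  toEvent n q = splitAt n (cast (sym (n+n≡2*n n)) q)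

  fromEvent : ∀ n → Event n → Fin (2 * n)
  fromEvent n e = cast (n+n≡2*n n) (join n n e)

  fromEvent-toEvent : ∀ n q → fromEvent n (toEvent n q) ≡ q
  fromEvent-toEvent n q = trans
    (cong (cast (n+n≡2*n n)) (FinP.join-splitAt n n (cast (sym (n+n≡2*n n)) q)))
    (FinP.cast-involutive (n+n≡2*n n) (sym (n+n≡2*n n)) q)

  toEvent-injective : ∀ n → Injective _≡_ _≡_ (toEvent n)
  toEvent-injective n {q} {q′} eq =
    trans (sym (fromEvent-toEvent n q)) (trans (cong (fromEvent n) eq) (fromEvent-toEvent n q′))

  event-surjective : ∀ {n} (f : Event n → Fin (2 * n)) → Injective _≡_ _≡_ f → ∀ q → ∃[ e ] f e ≡ q
  event-surjective {n} f inj q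
    with i , eq ← injective⇒surjective (f ∘ toEvent n) (toEvent-injective n ∘ inj) q = toEvent n i , eq

  -- As f is onto, an element with f-value v ends a chain of v + 1 elements along which f,
  -- and therefore g, increases.
  monotone-≤ : ∀ {m} {E : Set} (f g : E → Fin m) → (∀ q → ∃[ e ] f e ≡ q) →
          (∀ e e′ → f e Fin.< f e′ → g e Fin.< g e′) → ∀ e → toℕ (f e) ≤ toℕ (g e)
  monotone-≤ f g onto mono e = go _ e refl
    where
    go : ∀ v e → toℕ (f e) ≡ v → toℕ (f e) ≤ toℕ (g e)
    go zero    e eq = subst (_≤ toℕ (g e)) (sym eq) z≤n
    go (suc v) e eq
      with e′ , fe′≡ ← onto (fromℕ< (<-trans (≤-reflexive (sym eq)) (FinP.toℕ<n (f e))))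
      = ≤-trans (≤-reflexive eq) (≤-<-trans
          (≤-trans (≤-reflexive (sym eq′)) (go v e′ eq′))
          (mono e′ e (subst₂ _<_ (sym eq′) (sym eq) ≤-refl)))
      where
      eq′ : toℕ (f e′) ≡ v
      eq′ = trans (cong toℕ fe′≡) (FinP.toℕ-fromℕ< _)

  module Keys {n : ℕ} (A : Fin n → ℕ) where

    -- Lexicographic order on pairs: (i , n) for the closer i, and (A i , i) for the opener
    -- i, which thus comes after A i closers and, among the openers with this property,
    -- after those of smaller index.
    key : Event n → ℕ
    key (opener i) = A i * suc n + toℕ i
    key (closer i) = toℕ i * suc n + n

    lex-< : ∀ {a b x y} → x ≤ n → a < b → a * suc n + x < b * suc n + y
    lex-< {a} {b} {x} {y} x≤n a<b = begin-strict
      a * suc n + x      ≤⟨ +-monoʳ-≤ (a * suc n) x≤n ⟩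
      a * suc n + n      <⟨ +-monoʳ-< (a * suc n) ≤-refl ⟩
      a * suc n + suc n  ≡⟨ +-comm (a * suc n) (suc n) ⟩
      suc a * suc n      ≤⟨ *-monoˡ-≤ (suc n) a<b ⟩
      b * suc n          ≤⟨ m≤m+n (b * suc n) y ⟩
      b * suc n + y      ∎
      where open ≤-Reasoning

    lex-<⁻ : ∀ {a b x y} → y ≤ n → a * suc n + x < b * suc n + y → a < b ⊎ (a ≡ b × x < y)
    lex-<⁻ {a} {b} {x} {y} y≤n lt with <-cmp a b
    ... | tri< a<b _ _  = inj₁ a<b
    ... | tri≈ _ refl _ = inj₂ (refl , +-cancelˡ-< (a * suc n) x y lt)
    ... | tri> _ _ b<a  = contradiction lt (<-asym (lex-< y≤n b<a))

    lex-injective : ∀ {a b x y} → x ≤ n → y ≤ n → a * suc n + x ≡ b * suc n + y → a ≡ b × x ≡ y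
    lex-injective {a} {b} {x} {y} x≤n y≤n eq with <-cmp a b
    ... | tri< a<b _ _  = contradiction eq (<⇒≢ (lex-< x≤n a<b))
    ... | tri≈ _ refl _ = refl , +-cancelˡ-≡ (a * suc n) x y eq
    ... | tri> _ _ b<a  = contradiction (sym eq) (<⇒≢ (lex-< y≤n b<a))

    toℕ≤ : (i : Fin n) → toℕ i ≤ n
    toℕ≤ i = <⇒≤ (FinP.toℕ<n i)

    key-injective : ∀ {e e′} → key e ≡ key e′ → e ≡ e′
    key-injective {opener i} {opener j} eq =
      cong inj₁ (FinP.toℕ-injective (proj₂ (lex-injective {A i} {A j} (toℕ≤ i) (toℕ≤ j) eq)))
    key-injective {opener i} {closer j} eq =
      contradiction (proj₂ (lex-injective {A i} {toℕ j} (toℕ≤ i) ≤-refl eq)) (<⇒≢ (FinP.toℕ<n i))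
    key-injective {closer i} {opener j} eq =
      contradiction (sym (proj₂ (lex-injective {toℕ i} {A j} ≤-refl (toℕ≤ j) eq))) (<⇒≢ (FinP.toℕ<n j))
    key-injective {closer i} {closer j} eq =
      cong inj₂ (FinP.toℕ-injective (proj₁ (lex-injective {toℕ i} {toℕ j} ≤-refl ≤-refl eq)))

    closer<closer : ∀ {i j} → toℕ i < toℕ j → key (closer i) < key (closer j)
    closer<closer = lex-< ≤-refl
    closer<opener : ∀ {i j} → toℕ i < A j → key (closer i) < key (opener j)
    closer<opener = lex-< ≤-refl
    opener<closer : ∀ {i j} → A i ≤ toℕ j → key (opener i) < key (closer j)
    opener<closer {i} {j} Ai≤j with m≤n⇒m<n∨m≡n Ai≤j
    ... | inj₁ Ai<j = lex-< (toℕ≤ i) Ai<j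
    ... | inj₂ Ai≡j rewrite Ai≡j = +-monoʳ-< (toℕ j * suc n) (FinP.toℕ<n i)
    openersBefore closersBefore : ℕ → Fin n → Bool
    openersBefore m j = key (opener j) <ᵇ m
    closersBefore m j = key (closer j) <ᵇ m

    place-ℕ : Event n → ℕ
    place-ℕ e = cnt (openersBefore (key e)) + cnt (closersBefore (key e))

    private
      weaken : ∀ x {y z} → y ≤ z → (x <ᵇ y) ≡ true → (x <ᵇ z) ≡ true
      weaken x {y} y≤z lt = <⇒<ᵇ≡true (<-≤-trans (does⇒ (x <? y) lt) y≤z)
      irrefl : ∀ x → (x <ᵇ x) ≡ false
      irrefl x = ≥⇒<ᵇ≡false {x} ≤-refl

    openersBefore-mono : ∀ {m m′} → m ≤ m′ → cnt (openersBefore m) ≤ cnt (openersBefore m′)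
    openersBefore-mono {m} {m′} m≤m′ =
      cnt-mono (openersBefore m) (openersBefore m′) λ j → weaken (key (opener j)) m≤m′

    closersBefore-mono : ∀ {m m′} → m ≤ m′ → cnt (closersBefore m) ≤ cnt (closersBefore m′)
    closersBefore-mono {m} {m′} m≤m′ =
      cnt-mono (closersBefore m) (closersBefore m′) λ j → weaken (key (closer j)) m≤m′

    place-ℕ-mono : ∀ {e e′} → key e < key e′ → place-ℕ e < place-ℕ e′
    place-ℕ-mono {opener i} {e′} lt = +-mono-<-≤
      (cnt-strict (openersBefore (key (opener i))) (openersBefore (key e′)) (λ j → weaken (key (opener j)) (<⇒≤ lt))
                  i (irrefl (key (opener i))) (<⇒<ᵇ≡true lt))
      (closersBefore-mono (<⇒≤ lt))
    place-ℕ-mono {closer i} {e′} lt = +-mono-≤-<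
      (openersBefore-mono (<⇒≤ lt))
      (cnt-strict (closersBefore (key (closer i))) (closersBefore (key e′)) (λ j → weaken (key (closer j)) (<⇒≤ lt))
                  i (irrefl (key (closer i))) (<⇒<ᵇ≡true lt))

    place-ℕ-bound : ∀ e → place-ℕ e < 2 * n
    place-ℕ-bound e = <-≤-trans (strict e) (≤-reflexive (n+n≡2*n n))
      where
      not-all : (b : Fin n → Bool) → ∀ i → b i ≡ false → cnt b < n
      not-all b i bi = <-≤-trans (cnt-strict b (λ _ → true) (λ _ _ → refl) i bi refl) (cnt-≤ {n} λ _ → true)
      strict : ∀ e → place-ℕ e < n + n
      strict (opener i) = +-mono-<-≤
        (not-all (openersBefore (key (opener i))) i (irrefl (key (opener i))))
        (cnt-≤ (closersBefore (key (opener i))))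
      strict (closer i) = +-mono-≤-<
        (cnt-≤ (openersBefore (key (closer i))))
        (not-all (closersBefore (key (closer i))) i (irrefl (key (closer i))))

    place : Event n → Fin (2 * n)
    place e = fromℕ< (place-ℕ-bound e)

    place-mono : ∀ {e e′} → key e < key e′ → place e Fin.< place e′
    place-mono {e} {e′} lt = subst₂ _<_ (sym (FinP.toℕ-fromℕ< _)) (sym (FinP.toℕ-fromℕ< _)) (place-ℕ-mono {e} {e′} lt)

    place-mono⁻ : ∀ {e e′} → place e Fin.< place e′ → key e < key e′
    place-mono⁻ {e} {e′} lt with <-cmp (key e) (key e′)
    ... | tri< key< _ _ = key<
    ... | tri≈ _ key≡ _ = contradiction (cong (toℕ ∘ place) (key-injective {e} {e′} key≡)) (<⇒≢ lt)
    ... | tri> _ _ key> = contradiction lt (<-asym (place-mono {e′} {e} key>))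

    place-injective : Injective _≡_ _≡_ place
    place-injective {e} {e′} eq with <-cmp (key e) (key e′)
    ... | tri< key< _ _ = contradiction (cong toℕ eq) (<⇒≢ (place-mono {e} {e′} key<))
    ... | tri≈ _ key≡ _ = key-injective key≡
    ... | tri> _ _ key> = contradiction (cong toℕ (sym eq)) (<⇒≢ (place-mono {e′} {e} key>))

    place-surjective : ∀ q → ∃[ e ] place e ≡ q
    place-surjective = event-surjective place place-injective

    -- Both f and place are bijections onto an initial segment, so the order that they
    -- induce determines them.
    place-unique : (f : Event n → Fin (2 * n)) → Injective _≡_ _≡_ f →
                   (∀ {e e′} → key e < key e′ → f e Fin.< f e′) → ∀ e → f e ≡ place e
    place-unique f inj mono e = FinP.toℕ-injective (≤-antisym
      (monotone-≤ f place (event-surjective f inj) (λ e e′ lt → place-mono {e} {e′} (mono⁻ lt)) e)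
      (monotone-≤ place f place-surjective (λ e e′ lt → mono (place-mono⁻ {e} {e′} lt)) e))
      where
      mono⁻ : ∀ {e e′} → f e Fin.< f e′ → key e < key e′
      mono⁻ {e} {e′} lt with <-cmp (key e) (key e′)
      ... | tri< key< _ _ = key<
      ... | tri≈ _ key≡ _ = contradiction (cong (toℕ ∘ f) (key-injective {e} {e′} key≡)) (<⇒≢ lt)
      ... | tri> _ _ key> = contradiction lt (<-asym (mono key>))

    matching : ArcVec n
    matching = tabulate λ i → place (opener i) , place (closer i)

    op-matching : ∀ i → op (lookup matching i) ≡ place (opener i)
    op-matching i = cong op (VecP.lookup∘tabulate _ i)
    cl-matching : ∀ i → cl (lookup matching i) ≡ place (closer i)
    cl-matching i = cong cl (VecP.lookup∘tabulate _ i)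

    module _ (A≤ : ∀ i → A i ≤ toℕ i) where

      isMatching-matching : IsMatching matching
      isMatching-matching = isMatching
        (λ i → subst₂ Fin._<_ (sym (op-matching i)) (sym (cl-matching i))
                 (place-mono {opener i} {closer i} (opener<closer (A≤ i))))
        part
        (λ i j i<j → subst₂ Fin._<_ (sym (cl-matching i)) (sym (cl-matching j))
                 (place-mono {closer i} {closer j} (closer<closer i<j)))
        where
        arc : Event n → Fin n
        arc (opener i) = i
        arc (closer i) = i
        on : ∀ e → place e ∈ᵃ lookup matching (arc e)
        on (opener i) = inj₁ (sym (op-matching i))
        on (closer i) = inj₂ (sym (cl-matching i))
        off : ∀ e j → place e ∈ᵃ lookup matching j → arc e ≡ j
        off e j (inj₁ eq) = cong arc (place-injective {e} {opener j} (trans eq (op-matching j)))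
        off e j (inj₂ eq) = cong arc (place-injective {e} {closer j} (trans eq (cl-matching j)))
        part : ∀ q → ∃[ i ] (q ∈ᵃ lookup matching i × (∀ j → q ∈ᵃ lookup matching j → i ≡ j))
        part q with e , refl ← place-surjective q = arc e , on e , off e

      -- Openers with no closer between them are ordered like their closers, and openers
      -- with different entries are separated by a closer.
      noLeftNesting-matching : NoLeftNesting matching
      noLeftNesting-matching (i , j , (opj<opi , _ , cli<clj) , adjacent)
        rewrite op-matching i | op-matching j | cl-matching i | cl-matching j
        with lex-<⁻ {A j} {A i} (toℕ≤ i) (place-mono⁻ {opener j} {opener i} opj<opi)
           | lex-<⁻ {toℕ i} {toℕ j} ≤-refl (place-mono⁻ {closer i} {closer j} cli<clj)
      ... | inj₂ (_ , j<i) | inj₁ i<j       = <-asym i<j j<i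
      ... | _              | inj₂ (_ , n<n) = <-irrefl refl n<n
      ... | inj₁ Aj<Ai     | _ = <⇒≱
              (place-mono {opener j} {closer c} (opener<closer (≤-reflexive (sym c≡))))
              (≤-pred (<-≤-trans (place-mono {closer c} {opener i} (closer<opener (subst (_< A i) (sym c≡) Aj<Ai)))
                                 (≤-reflexive (sym adjacent))))
        where
        c : Fin n
        c = fromℕ< (<-≤-trans Aj<Ai (≤-trans (A≤ i) (toℕ≤ i)))
        c≡ : toℕ c ≡ A j
        c≡ = FinP.toℕ-fromℕ< _

open CodeToMatching

-- The code of a matching
module MatchingToCode where
  open import Data.Nat using (_*_)

  codeFun : ArcVec n → Fin n → ℕ
  codeFun M i = # (λ j → cl (lookup M j) FinP.<? op (lookup M i))

  module FromMatching {n} (M : ArcVec n) (isM : IsMatching M) where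
    open IsMatching isM

    opM clM : Fin n → Fin (2 * n)
    opM i = op (lookup M i)
    clM i = cl (lookup M i)

    C : Fin n → ℕ
    C = codeFun M

    private
      before : Fin n → Fin n → Bool
      before i j = does (clM j FinP.<? opM i)

      -- The closers are increasing, so those to the left of an opener belong to an initial
      -- segment of the arcs, and their number determines them.
      before-initial : ∀ i j → before i j ≡ (toℕ j <ᵇ C i)
      before-initial i j = trans
        (initial-segment (before i) (λ j j′ j<j′ bj′ → dec-true (clM j FinP.<? opM i)
            (<-trans (increasing j j′ j<j′) (does⇒ (clM j′ FinP.<? opM i) bj′))) j)
        (cong (toℕ j <ᵇ_) (sym (#≡cnt (λ j → clM j FinP.<? opM i))))

    cl<op⇒ : ∀ {i j} → clM j Fin.< opM i → toℕ j < C i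
    cl<op⇒ {i} {j} lt = does⇒ (toℕ j <? C i)
      (trans (sym (before-initial i j)) (dec-true (clM j FinP.<? opM i) lt))

    cl<op⇐ : ∀ {i j} → toℕ j < C i → clM j Fin.< opM i
    cl<op⇐ {i} {j} lt = does⇒ (clM j FinP.<? opM i)
      (trans (before-initial i j) (dec-true (toℕ j <? C i) lt))

    same-arc : ∀ {q i j} → q ∈ᵃ lookup M i → q ∈ᵃ lookup M j → i ≡ j
    same-arc {q} q∈i q∈j with _ , _ , unique ← partition q = trans (sym (unique _ q∈i)) (unique _ q∈j)

    op≢cl : ∀ {i j} → opM i ≢ clM j
    op≢cl {i} {j} eq with refl ← same-arc {opM i} {i} {j} (inj₁ refl) (inj₂ eq) = <⇒≢ (op<cl i) (cong toℕ eq)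

    op≢cl′ : ∀ {i j} → toℕ (opM i) ≢ toℕ (clM j)
    op≢cl′ = op≢cl ∘ FinP.toℕ-injective

    position : Event n → Fin (2 * n)
    position (opener i) = opM i
    position (closer i) = clM i

    position-injective : Injective _≡_ _≡_ position
    position-injective {opener i} {opener j} eq = cong inj₁ (same-arc {opM i} (inj₁ refl) (inj₁ eq))
    position-injective {opener i} {closer j} eq = contradiction eq op≢cl
    position-injective {closer i} {opener j} eq = contradiction (sym eq) op≢cl
    position-injective {closer i} {closer j} eq = cong inj₂ (same-arc {clM i} (inj₂ refl) (inj₂ eq))

    C≤ : ∀ i → C i ≤ toℕ i
    C≤ i = ≮⇒≥ λ i<C → <-asym (op<cl i) (cl<op⇐ i<C)

    op<cl⇐ : ∀ {i j} → C i ≤ toℕ j → opM i Fin.< clM j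
    op<cl⇐ {i} {j} Ci≤j = ≤∧≢⇒< (≮⇒≥ λ lt → <⇒≱ (cl<op⇒ lt) Ci≤j) op≢cl′

    op<cl⇒ : ∀ {i j} → opM i Fin.< clM j → C i ≤ toℕ j
    op<cl⇒ lt = ≮⇒≥ λ j<C → <-asym lt (cl<op⇐ j<C)

    module _ (noNest : NoLeftNesting M) where

      -- Otherwise the openers of j and, further right, of i have no closer between them, as
      -- equally many closers precede both.  From one opener to the next the index of the
      -- arc increases, for want of left nestings; hence j < i.
      openers-in-run : ∀ {i j} → C i ≡ C j → toℕ i < toℕ j → opM i Fin.< opM j
      openers-in-run {i} {j} same i<j with <-cmp (toℕ (opM i)) (toℕ (opM j))
      ... | tri< lt _ _ = lt
      ... | tri≈ _ eq _ = contradiction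
        (cong toℕ (same-arc {opM i} {i} {j} (inj₁ refl) (inj₁ (FinP.toℕ-injective eq)))) (<⇒≢ i<j)
      ... | tri> _ _ opj<opi = contradiction (climb (toℕ (opM i) ∸ toℕ (opM j)) (opM i)
                                 (m+[n∸m]≡n (<⇒≤ opj<opi)) ≤-refl)
          λ { (b , opb≡ , j≤b) → <⇒≱ i<j (≤-trans j≤b (≤-reflexive (cong toℕ
                (same-arc {opM i} {b} {i} (inj₁ (sym opb≡)) (inj₁ refl))))) }
        where
        climb : ∀ d q → toℕ (opM j) + d ≡ toℕ q → toℕ q ≤ toℕ (opM i) →
                ∃[ b ] (opM b ≡ q × toℕ j ≤ toℕ b)
        climb zero    q eq q≤ = j , FinP.toℕ-injective (trans (sym (+-identityʳ _)) eq) , ≤-refl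
        climb (suc d) q eq q≤ = next (climb d q⁻ (sym q⁻≡) (≤-trans (n≤1+n _) (≤-trans (≤-reflexive adjacent) q≤)))
          where
          q⁻<2n : toℕ (opM j) + d < 2 * n
          q⁻<2n = <-trans (≤-reflexive (trans (sym (+-suc _ d)) eq)) (FinP.toℕ<n q)
          q⁻ : Fin (2 * n)
          q⁻ = fromℕ< q⁻<2n
          q⁻≡ : toℕ q⁻ ≡ toℕ (opM j) + d
          q⁻≡ = FinP.toℕ-fromℕ< q⁻<2n
          adjacent : suc (toℕ q⁻) ≡ toℕ q
          adjacent = trans (cong suc q⁻≡) (trans (sym (+-suc _ d)) eq)
          opj<q : toℕ (opM j) < toℕ q
          opj<q = ≤-trans (s≤s (m≤m+n _ d)) (≤-reflexive (trans (sym (+-suc _ d)) eq))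
          next : ∃[ b ] (opM b ≡ q⁻ × toℕ j ≤ toℕ b) → ∃[ b ] (opM b ≡ q × toℕ j ≤ toℕ b)
          next (a , opa≡ , j≤a) with partition q
          ... | b , inj₁ refl , _ = b , refl , ≮⇒≥ λ b<j → noNest
            (b , a , (≤-reflexive adjacent′ , op<cl b , increasing b a (<-≤-trans b<j j≤a)) , adjacent′)
            where
            adjacent′ : suc (toℕ (opM a)) ≡ toℕ (opM b)
            adjacent′ = trans (cong (suc ∘ toℕ) opa≡) adjacent
          ... | b , inj₂ refl , _ = contradiction
            (cl<op⇐ {j} {b} (subst (toℕ b <_) same (cl<op⇒ {i} {b} (≤∧≢⇒< q≤ (≢-sym op≢cl′)))))
            (<-asym opj<q)

      open Keys C

      position-mono : ∀ {e e′} → key e < key e′ → position e Fin.< position e′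
      position-mono {closer i} {closer j} lt with lex-<⁻ {toℕ i} {toℕ j} ≤-refl lt
      ... | inj₁ i<j       = increasing i j i<j
      ... | inj₂ (_ , n<n) = contradiction n<n (<-irrefl refl)
      position-mono {closer i} {opener j} lt with lex-<⁻ {toℕ i} {C j} (toℕ≤ j) lt
      ... | inj₁ i<Cj      = cl<op⇐ i<Cj
      ... | inj₂ (_ , n<j) = contradiction n<j (≤⇒≯ (toℕ≤ j))
      position-mono {opener i} {closer j} lt with lex-<⁻ {C i} {toℕ j} ≤-refl lt
      ... | inj₁ Ci<j      = op<cl⇐ (<⇒≤ Ci<j)
      ... | inj₂ (Ci≡j , _) = op<cl⇐ (≤-reflexive Ci≡j)
      position-mono {opener i} {opener j} lt with lex-<⁻ {C i} {C j} (toℕ≤ j) lt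
      ... | inj₂ (Ci≡Cj , i<j) = openers-in-run Ci≡Cj i<j
      ... | inj₁ Ci<Cj = <-trans (op<cl⇐ {i} {c} (≤-reflexive (sym c≡))) (cl<op⇐ {j} {c} (subst (_< C j) (sym c≡) Ci<Cj))
        where
        c : Fin n
        c = fromℕ< (<-≤-trans Ci<Cj (≤-trans (C≤ j) (toℕ≤ j)))
        c≡ : toℕ c ≡ C i
        c≡ = FinP.toℕ-fromℕ< _

      position≡place : ∀ e → position e ≡ place e
      position≡place = place-unique position position-injective (λ {e} {e′} → position-mono {e} {e′})

      matching-codeFun : M ≡ matching
      matching-codeFun = trans (sym (VecP.tabulate∘lookup M)) (VecP.tabulate-cong λ i →
        cong₂ _,_ (position≡place (opener i)) (position≡place (closer i)))

  codeFun-matching : (A : Fin n → ℕ) → (∀ i → A i ≤ toℕ i) → ∀ i → codeFun (Keys.matching A) i ≡ A i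
  codeFun-matching {n} A A≤ i = begin
    codeFun matching i
      ≡⟨ #≡cnt (λ j → cl (lookup matching j) FinP.<? op (lookup matching i)) ⟩
    cnt (λ j → does (cl (lookup matching j) FinP.<? op (lookup matching i)))
      ≡⟨ (cnt-cong {n} _ (λ j → toℕ j <ᵇ A i) λ j → does-≡ (cl (lookup matching j) FinP.<? op (lookup matching i))
            (λ lt → dec-true (toℕ j <? A i) (to j lt))
            (λ eq → from j (does⇒ (toℕ j <? A i) eq))) ⟩
    cnt {n} (λ j → toℕ j <ᵇ A i)
      ≡⟨ cnt-<ᵇ {n = n} (≤-trans (A≤ i) (toℕ≤ i)) ⟩
    A i ∎
    where
    open ≡-Reasoning
    open Keys A
    from : ∀ j → toℕ j < A i → cl (lookup matching j) Fin.< op (lookup matching i)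
    from j j<Ai rewrite op-matching i | cl-matching j = place-mono {closer j} {opener i} (closer<opener j<Ai)
    to : ∀ j → cl (lookup matching j) Fin.< op (lookup matching i) → toℕ j < A i
    to j lt rewrite op-matching i | cl-matching j
      with lex-<⁻ {toℕ j} {A i} (toℕ≤ i) (place-mono⁻ {closer j} {opener i} lt)
    ... | inj₁ j<Ai      = j<Ai
    ... | inj₂ (_ , n<i) = contradiction n<i (≤⇒≯ (toℕ≤ i))

  matchingCode : ArcVec n → Vec ℕ n
  matchingCode M = fromFun (codeFun M)

  ∈-𝒩⁻ : {M : ArcVec n} → M ∈ 𝒩 n → IsMatching M × NoLeftNesting M
  ∈-𝒩⁻ {n} M∈ = proj₂ (∈-filter⁻ _ {xs = vectors (cartesianProduct (allFin (2 * n)) (allFin (2 * n))) n} M∈)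

  ∈-𝒩⁺ : (M : ArcVec n) → IsMatching M → NoLeftNesting M → M ∈ 𝒩 n
  ∈-𝒩⁺ {n} M isM noNest = ∈-filter⁺ _
    (∈-vectors (λ (p , q) → ∈-cartesianProduct⁺ (∈-allFin p) (∈-allFin q)) M) (isM , noNest)

  𝒩-unique : ∀ n → Unique (𝒩 n)
  𝒩-unique n = Unq.filter⁺ _ (vectors-unique (Unq.cartesianProduct⁺ (Unq.allFin⁺ (2 * n)) (Unq.allFin⁺ (2 * n))) n)

  fromFun-injective : {f g : Fin n → ℕ} → fromFun f ≡ fromFun g → ∀ i → f i ≡ g i
  fromFun-injective {f = f} {g} eq i =
    trans (sym (at-fromFun f i)) (trans (cong (λ a → at a (toℕ i)) eq) (at-fromFun g i))

  matchingCode-↭ : ∀ n → map matchingCode (𝒩 n) ↭ codes n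
  matchingCode-↭ n = unique-↭ (map-unique matchingCode injective (𝒩-unique n)) (codes-unique n) to from
    where
    place-cong : ∀ {A B : Fin n → ℕ} → (∀ i → A i ≡ B i) → Keys.matching A ≡ Keys.matching B
    place-cong {A} {B} eq = VecP.tabulate-cong λ i → cong₂ _,_ (go (opener i)) (go (closer i))
      where
      key-cong : ∀ e → Keys.key A e ≡ Keys.key B e
      key-cong (opener i) = cong (λ c → c * suc n + toℕ i) (eq i)
      key-cong (closer i) = refl
      go : ∀ e → Keys.place A e ≡ Keys.place B e
      go = Keys.place-unique B (Keys.place A) (Keys.place-injective A)
        λ {e} {e′} lt → Keys.place-mono A {e} {e′} (subst₂ _<_ (sym (key-cong e)) (sym (key-cong e′)) lt)

    injective : ∀ {M M′} → M ∈ 𝒩 n → M′ ∈ 𝒩 n → matchingCode M ≡ matchingCode M′ → M ≡ M′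
    injective {M} {M′} M∈ M′∈ eq with isM , noNest ← ∈-𝒩⁻ M∈ | isM′ , noNest′ ← ∈-𝒩⁻ M′∈ =
      trans (FromMatching.matching-codeFun M isM noNest)
        (trans (place-cong (fromFun-injective eq)) (sym (FromMatching.matching-codeFun M′ isM′ noNest′)))

    to : ∀ {a} → a ∈ map matchingCode (𝒩 n) → a ∈ codes n
    to a∈ with M , M∈ , refl ← ∈-map⁻ matchingCode a∈ =
      ∈-codes⁺ _ (fromFun-isCode (codeFun M) (FromMatching.C≤ M (proj₁ (∈-𝒩⁻ M∈))))

    from : ∀ {a} → a ∈ codes n → a ∈ map matchingCode (𝒩 n)
    from {a} a∈ = subst (_∈ map matchingCode (𝒩 n))
      (trans (fromFun-cong (codeFun-matching A A≤)) (fromFun-at a))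
      (∈-map⁺ matchingCode (∈-𝒩⁺ (Keys.matching A)
        (Keys.isMatching-matching A A≤) (Keys.noLeftNesting-matching A A≤)))
      where
      A : Fin n → ℕ
      A = at a ∘ toℕ
      A≤ : ∀ i → A i ≤ toℕ i
      A≤ i = isCode-at a (∈-codes⁻ a a∈) (toℕ i) (FinP.toℕ<n i)

open MatchingToCode

-- Statistics of matchings
module MatchingStatistics where
  open import Data.Nat using (_*_)

  module MatchingStats {k} (M : ArcVec (suc k)) (isM : IsMatching M) (noNest : NoLeftNesting M) where
    open IsMatching isM
    open FromMatching M isM
    open Keys C
    open Tree numericalTree using (unusedRises; unusedRests; rise)

    cl<cl⇒ : ∀ {i j} → clM i Fin.< clM j → toℕ i < toℕ j
    cl<cl⇒ {i} {j} lt with <-cmp (toℕ i) (toℕ j)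
    ... | tri< i<j _ _ = i<j
    ... | tri≈ _ i≡j _ = contradiction (cong (toℕ ∘ clM) (FinP.toℕ-injective i≡j)) (<⇒≢ lt)
    ... | tri> _ _ j<i = contradiction lt (<-asym (increasing j i j<i))

    -- An arc j with C j ≡ toℕ i is opened between the closers of h and i.
    run⇒unused : ∀ {h i} → h ⋖ i → clM h ⋖ clM i → ∀ j → C j ≢ toℕ i
    run⇒unused {h} {i} h⋖i adjacent j Cj≡i = <⇒≱
      (cl<op⇐ {j} {h} (≤-reflexive (trans h⋖i (sym Cj≡i))))
      (≤-pred (≤-trans (op<cl⇐ {j} {i} (≤-reflexive Cj≡i)) (≤-reflexive (sym adjacent))))

    unused⇒run : ∀ {h i} → h ⋖ i → (∀ j → C j ≢ toℕ i) → clM h ⋖ clM i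
    unused⇒run {h} {i} h⋖i unused = trans (sym q≡) (cong toℕ q-is-closer)
      where
      clh<cli : clM h Fin.< clM i
      clh<cli = increasing h i (≤-reflexive h⋖i)
      q<2n : suc (toℕ (clM h)) < 2 * suc k
      q<2n = ≤-<-trans clh<cli (FinP.toℕ<n (clM i))
      q : Fin (2 * suc k)
      q = fromℕ< q<2n
      q≡ : toℕ q ≡ suc (toℕ (clM h))
      q≡ = FinP.toℕ-fromℕ< q<2n
      q≤cli : toℕ q ≤ toℕ (clM i)
      q≤cli = ≤-trans (≤-reflexive q≡) clh<cli
      clh<q : toℕ (clM h) < toℕ q
      clh<q = ≤-reflexive (sym q≡)
      q-is-closer : q ≡ clM i
      q-is-closer with partition q
      ... | b , inj₁ q≡op , _ = contradiction (≤-antisym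
          (op<cl⇒ {b} {i} (≤∧≢⇒< (subst (_≤ _) (cong toℕ q≡op) q≤cli) op≢cl′))
          (≤-trans (≤-reflexive (sym h⋖i)) (cl<op⇒ {b} {h} (subst (_ <_) (cong toℕ q≡op) clh<q))))
        (unused b)
      ... | b , inj₂ q≡cl , _ = FinP.toℕ-injective (≤-antisym q≤cli
          (≤-trans (clᵢ≤ (≤-trans (≤-reflexive (sym h⋖i)) (cl<cl⇒ {h} {b} (subst (_ <_) (cong toℕ q≡cl) clh<q))))
                   (≤-reflexive (cong toℕ (sym q≡cl)))))
        where
        clᵢ≤ : toℕ i ≤ toℕ b → toℕ (clM i) ≤ toℕ (clM b)
        clᵢ≤ i≤b with m≤n⇒m<n∨m≡n i≤b
        ... | inj₁ i<b = <⇒≤ (increasing i b i<b)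
        ... | inj₂ i≡b = ≤-reflexive (cong (toℕ ∘ clM) (FinP.toℕ-injective i≡b))

    op<op⇒ : ∀ {h i} → h ⋖ i → opM i Fin.< opM h → C i < C h
    op<op⇒ {h} {i} h⋖i lt
      with lex-<⁻ {C i} {C h} (toℕ≤ h) (place-mono⁻ {opener i} {opener h}
             (subst₂ Fin._<_ (position≡place noNest (opener i)) (position≡place noNest (opener h)) lt))
    ... | inj₁ Ci<Ch     = Ci<Ch
    ... | inj₂ (_ , i<h) = contradiction i<h (<-asym (≤-reflexive h⋖i))

    op<op⇐ : ∀ {h i} → C i < C h → opM i Fin.< opM h
    op<op⇐ {h} {i} lt = position-mono noNest {opener i} {opener h} (lex-< (toℕ≤ i) lt)

    a : Vec ℕ (suc k)
    a = matchingCode M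

    unused : ℕ → Bool
    unused v = not (mem (suc v) a)

    unused⇒ : ∀ {v} → unused v ≡ true → ∀ j → C j ≢ suc v
    unused⇒ {v} eq j Cj≡ with () ← trans (sym eq) (cong not
      (trans (cong (λ c → mem c a) (sym Cj≡)) (mem-fromFun⁺ C j)))

    unused⇐ : ∀ {v} → (∀ j → C j ≢ suc v) → unused v ≡ true
    unused⇐ {v} none with mem (suc v) a in eq
    ... | false = refl
    ... | true with j , Cj≡ ← mem-fromFun⁻ C (suc v) eq = contradiction Cj≡ (none j)

    continues-suc : (i : Fin k) → does (continuesRun? M (suc i)) ≡ unused (toℕ i)
    continues-suc i = does-≡ (continuesRun? M (suc i))
      (λ (h , h⋖i , adjacent) → unused⇐ (run⇒unused {h} {suc i} h⋖i adjacent))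
      (λ eq → inject₁ i , h⋖ , unused⇒run {inject₁ i} {suc i} h⋖ (unused⇒ eq))
      where
      h⋖ : inject₁ i ⋖ suc i
      h⋖ = cong suc (FinP.toℕ-inject₁ i)

    rise-suc : (i : Fin k) → rise a (toℕ i) ≡ (C (suc i) <ᵇ C (inject₁ i))
    rise-suc i = trans (numerical-rise a (FinP.toℕ<n i)) (cong₂ _<ᵇ_
      (at-fromFun C (suc i))
      (trans (cong (at a) (sym (FinP.toℕ-inject₁ i))) (at-fromFun C (inject₁ i))))

    rightNesting-suc : (i : Fin k) → does (isRightNesting? M (suc i)) ≡ unused (toℕ i) ∧ rise a (toℕ i)
    rightNesting-suc i = does-≡ (isRightNesting? M (suc i)) to from
      where
      h = inject₁ i
      h⋖ : h ⋖ suc i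
      h⋖ = cong suc (FinP.toℕ-inject₁ i)
      to : IsRightNesting M (suc i) → unused (toℕ i) ∧ rise a (toℕ i) ≡ true
      to (h′ , h′⋖i , op<op , _ , adjacent)
        with refl ← FinP.toℕ-injective {i = h′} {j = h} (suc-injective (trans h′⋖i (sym h⋖))) = cong₂ _∧_
          (unused⇐ (run⇒unused {h′} {suc i} h′⋖i adjacent))
          (trans (rise-suc i) (<⇒<ᵇ≡true (op<op⇒ {h′} {suc i} h′⋖i op<op)))
      from : unused (toℕ i) ∧ rise a (toℕ i) ≡ true → IsRightNesting M (suc i)
      from eq = h , h⋖ , op<op⇐ {h} {suc i} (does⇒ (C (suc i) <? C h) (trans (sym (rise-suc i)) (∧-conicalʳ _ _ eq)))
        , op<cl h , unused⇒run {h} {suc i} h⋖ (unused⇒ (∧-conicalˡ _ _ eq))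

    min-stat : min M ≡ zeros a
    min-stat = begin
      min M
        ≡⟨ #≡cnt (opensBeforeFirstCloser? M) ⟩
      cnt (does ∘ opensBeforeFirstCloser? M)
        ≡⟨ (cnt-cong _ (λ i → C i ≡ᵇ 0) λ i → does-≡ (opensBeforeFirstCloser? M i)
             (λ (f , f≡0 , lt) → dec-true (C i ℕ.≟ 0) (n≤0⇒n≡0 (subst (C i ≤_) f≡0 (op<cl⇒ {i} {f} lt))))
             (λ eq → zero , refl , op<cl⇐ {i} {zero} (≤-reflexive (does⇒ (C i ℕ.≟ 0) eq)))) ⟩
      cnt (λ i → C i ≡ᵇ 0)
        ≡⟨ zeros-fromFun C ⟨
      zeros a ∎
      where open ≡-Reasoning

    rne-stat : rne M ≡ unusedRises a
    rne-stat = begin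
      rne M
        ≡⟨ #≡cnt (isRightNesting? M) ⟩
      χ (does (isRightNesting? M zero)) + cnt (does ∘ isRightNesting? M ∘ suc)
        ≡⟨ cong₂ (λ b c → χ b + c) (dec-false (isRightNesting? M zero) λ { (_ , () , _) })
             (cnt-downFrom k (λ v → unused v ∧ rise a v) rightNesting-suc) ⟩
      unusedRises a ∎
      where open ≡-Reasoning

    continues-stat : # (continuesRun? M) ≡ unusedRises a + unusedRests a
    continues-stat = begin
      # (continuesRun? M)
        ≡⟨ #≡cnt (continuesRun? M) ⟩
      χ (does (continuesRun? M zero)) + cnt (does ∘ continuesRun? M ∘ suc)
        ≡⟨ cong₂ (λ b c → χ b + c) (dec-false (continuesRun? M zero) λ { (_ , () , _) })
             (cnt-downFrom k unused continues-suc) ⟩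
      Σ∈ (downFrom k) (χ ∘ unused)
        ≡⟨ (Σ∈-cong (downFrom k) λ v _ → split (unused v) (rise a v)) ⟩
      Σ∈ (downFrom k) (λ v → χ (unused v ∧ rise a v) + χ (unused v ∧ not (rise a v)))
        ≡⟨ Σ∈-+ (downFrom k) _ _ ⟩
      unusedRises a + unusedRests a ∎
      where
      open ≡-Reasoning
      split : ∀ u r → χ u ≡ χ (u ∧ r) + χ (u ∧ not r)
      split true  true  = refl
      split true  false = refl
      split false _     = refl

    int-stat : int M ∸ 1 ≡ k ∸ (unusedRises a + unusedRests a)
    int-stat = begin
      (suc k ∸ c) ∸ 1   ≡⟨ ∸-+-assoc (suc k) c 1 ⟩
      suc k ∸ (c + 1)   ≡⟨ cong (suc k ∸_) (+-comm c 1) ⟩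
      k ∸ c             ≡⟨ cong (k ∸_) continues-stat ⟩
      _                 ∎
      where
      open ≡-Reasoning
      c = # (continuesRun? M)

open MatchingStatistics

-- The code of a permutation
module PermutationCodes where
  insertBefore-injective : ∀ x c c′ ys zs → x ∉ ys → x ∉ zs → c ∈ ys → c′ ∈ zs →
    insertBefore x c ys ≡ insertBefore x c′ zs → c ≡ c′ × ys ≡ zs
  insertBefore-injective x c c′ (y ∷ ys) (z ∷ zs) x∉ys x∉zs c∈ c′∈ eq with c ≟ y | c′ ≟ z
  ... | yes refl | yes refl rewrite insertBefore-here x c ys | insertBefore-here x c′ zs
      with refl ← proj₂ (∷-injective eq) = refl , refl
  ... | yes refl | no c′≢z rewrite insertBefore-here x c ys | insertBefore-there x zs c′≢z
      = contradiction (here (proj₁ (∷-injective eq))) x∉zs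
  ... | no c≢y | yes refl rewrite insertBefore-there x ys c≢y | insertBefore-here x c′ zs
      = contradiction (here (sym (proj₁ (∷-injective eq)))) x∉ys
  ... | no c≢y | no c′≢z rewrite insertBefore-there x ys c≢y | insertBefore-there x zs c′≢z
      with y≡z , eq′ ← ∷-injective eq
      with c≡c′ , ys≡zs ← insertBefore-injective x c c′ ys zs (x∉ys ∘ there) (x∉zs ∘ there)
                            (Any.tail c≢y c∈) (Any.tail c′≢z c′∈) eq′
      = c≡c′ , cong₂ _∷_ y≡z ys≡zs

  arrange-injective : (a b : Vec ℕ n) → IsCode a → IsCode b → arrange a ≡ arrange b → a ≡ b
  arrange-injective []       []       _ _ _ = refl
  arrange-injective {suc n} (c ∷ as) (c′ ∷ bs) (c≤n , okᵃ) (c′≤n , okᵇ) eq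
    with refl , eq′ ← insertBefore-injective (suc n) c c′ (arrange as) (arrange bs)
           (λ x∈ → 1+n≰n (∈-arrange⁻ as x∈)) (λ x∈ → 1+n≰n (∈-arrange⁻ bs x∈))
           (∈-arrange⁺ as c≤n) (∈-arrange⁺ bs c′≤n) eq
    = cong (c ∷_) (arrange-injective as bs okᵃ okᵇ eq′)

  insertBefore-split : ∀ x c α β → c ∉ α → insertBefore x c (α ++ c ∷ β) ≡ α ++ x ∷ c ∷ β
  insertBefore-split x c []      β c∉ = insertBefore-here x c β
  insertBefore-split x c (y ∷ α) β c∉ = trans (insertBefore-there x _ (c∉ ∘ here))
                                              (cong (y ∷_) (insertBefore-split x c α β (c∉ ∘ there)))

  unique-∉-prefix : ∀ {c : ℕ} α β → Unique (α ++ c ∷ β) → c ∉ α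
  unique-∉-prefix (y ∷ α) β (y∉ ∷ u) (here refl) = All.lookup y∉ (∈-++⁺ʳ α (here refl)) refl
  unique-∉-prefix (y ∷ α) β (y∉ ∷ u) (there c∈)  = unique-∉-prefix α β u c∈

  -- The largest value is erased; the value to the right of it is the last entry of the
  -- code, and it exists because the list ends in 0.
  arrange-onto : ∀ n ys → EndsInZero ys → ys ↭ downFrom (suc n) → ∃[ a ] IsCode {n} a × arrange a ≡ ys
  arrange-onto zero    ys _ p = [] , tt , sym (↭P.↭-singleton-inv p)
  arrange-onto (suc n) ys (xs , refl , 0<xs) p
    with ∈-++⁻ xs (↭P.∈-resp-↭ (↭-sym p) (here refl))
  ... | inj₂ (here ())
  ... | inj₁ x∈ with α , β , refl ← ∈-∃++ x∈ = remove
    where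
    x = suc n
    split-eq : (γ : List ℕ) → (α ++ x ∷ β) ++ γ ≡ α ++ x ∷ (β ++ γ)
    split-eq γ = ++-assoc α (x ∷ β) γ
    split-eq′ : (γ : List ℕ) → (α ++ β) ++ γ ≡ α ++ (β ++ γ)
    split-eq′ γ = ++-assoc α β γ
    p′ : (α ++ β) ++ 0 ∷ [] ↭ downFrom (suc n)
    p′ = subst (_↭ downFrom (suc n)) (sym (split-eq′ _))
           (↭P.drop-mid α [] (subst (_↭ downFrom (suc (suc n))) (split-eq _) p))
    0<αβ : All (0 <_) (α ++ β)
    0<αβ = All.tabulate λ y∈ → All.lookup 0<xs (case ∈-++⁻ α y∈ of λ
      { (inj₁ y∈α) → ∈-++⁺ˡ y∈α ; (inj₂ y∈β) → ∈-++⁺ʳ α (there y∈β) })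
    attach : ∀ γ (a : Vec ℕ n) → IsCode a → arrange a ≡ α ++ γ → γ ≢ [] →
             ∃[ a ] IsCode {suc n} a × arrange a ≡ α ++ x ∷ γ
    attach []      a ok eq γ≢[] = contradiction refl γ≢[]
    attach (c ∷ γ) a ok eq _ = c ∷ a
      , (∈-arrange⁻ a (subst (c ∈_) (sym eq) (∈-++⁺ʳ α (here refl))) , ok)
      , trans (cong (insertBefore x c) eq) (insertBefore-split x c α γ
          (unique-∉-prefix α γ (subst Unique eq
            (unique-resp-↭ (↭-sym (arrange-↭ a)) (Unq.downFrom⁺ (suc n))))))
    remove : ∃[ a ] IsCode {suc n} a × arrange a ≡ (α ++ x ∷ β) ++ 0 ∷ []
    remove with a , ok , eq ← arrange-onto n ((α ++ β) ++ 0 ∷ []) (α ++ β , refl , 0<αβ) p′ =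
      subst (λ ys → ∃[ a ] IsCode {suc n} a × arrange a ≡ ys) (sym (split-eq _))
        (attach (β ++ 0 ∷ []) a ok (trans eq (split-eq′ _)) (λ e → nonempty β e))
      where
      nonempty : ∀ β → β ++ 0 ∷ [] ≢ []
      nonempty []      ()
      nonempty (_ ∷ _) ()

  siteList : Vec (Fin n) m → List ℕ
  siteList []       = 0 ∷ []
  siteList (y ∷ ys) = suc (toℕ y) ∷ siteList ys

  siteList-injective : (v w : Vec (Fin n) m) → siteList v ≡ siteList w → v ≡ w
  siteList-injective []      []      _  = refl
  siteList-injective (y ∷ v) (z ∷ w) eq with y≡z , eq′ ← ∷-injective eq =
    cong₂ _∷_ (FinP.toℕ-injective (suc-injective y≡z)) (siteList-injective v w eq′)

  ∈-siteList⁺ : (v : Vec (Fin n) m) → ∀ j → suc (toℕ (lookup v j)) ∈ siteList v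
  ∈-siteList⁺ (y ∷ v) zero    = here refl
  ∈-siteList⁺ (y ∷ v) (suc j) = there (∈-siteList⁺ v j)

  ∈-siteList⁻ : (v : Vec (Fin n) m) → ∀ {s} → s ∈ siteList v → s ≡ 0 ⊎ ∃[ j ] s ≡ suc (toℕ (lookup v j))
  ∈-siteList⁻ []      (here eq)  = inj₁ eq
  ∈-siteList⁻ (y ∷ v) (here eq)  = inj₂ (zero , eq)
  ∈-siteList⁻ (y ∷ v) (there s∈) with ∈-siteList⁻ v s∈
  ... | inj₁ eq       = inj₁ eq
  ... | inj₂ (j , eq) = inj₂ (suc j , eq)

  0∈siteList : (v : Vec (Fin n) m) → 0 ∈ siteList v
  0∈siteList []      = here refl
  0∈siteList (y ∷ v) = there (0∈siteList v)

  ∉-tail : (y : Fin n) (v : Vec (Fin n) m) → Injective _≡_ _≡_ (lookup (y ∷ v)) → suc (toℕ y) ∉ siteList v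
  ∉-tail y v inj s∈ with ∈-siteList⁻ v s∈
  ... | inj₂ (j , eq) with () ← inj {zero} {suc j} (FinP.toℕ-injective (suc-injective eq))

  tail-injective : (y : Fin n) (v : Vec (Fin n) m) → Injective _≡_ _≡_ (lookup (y ∷ v)) → Injective _≡_ _≡_ (lookup v)
  tail-injective y v inj eq = FinP.suc-injective (inj eq)

  siteList-unique : (v : Vec (Fin n) m) → Injective _≡_ _≡_ (lookup v) → Unique (siteList v)
  siteList-unique []      inj = [] ∷ []
  siteList-unique (y ∷ v) inj = All.tabulate (λ s∈ eq → ∉-tail y v inj (subst (_∈ siteList v) (sym eq) s∈))
                                ∷ siteList-unique v (tail-injective y v inj)

  siteList-unique⁻ : (v : Vec (Fin n) m) → Unique (siteList v) → Injective _≡_ _≡_ (lookup v)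
  siteList-unique⁻ (y ∷ v) (y∉ ∷ u) {zero}  {zero}  eq = refl
  siteList-unique⁻ (y ∷ v) (y∉ ∷ u) {zero}  {suc j} eq = contradiction (cong (suc ∘ toℕ) eq) (All.lookup y∉ (∈-siteList⁺ v j))
  siteList-unique⁻ (y ∷ v) (y∉ ∷ u) {suc i} {zero}  eq = contradiction (cong (suc ∘ toℕ) (sym eq)) (All.lookup y∉ (∈-siteList⁺ v i))
  siteList-unique⁻ (y ∷ v) (y∉ ∷ u) {suc i} {suc j} eq = cong suc (siteList-unique⁻ v u eq)

  siteList-endsInZero : (v : Vec (Fin n) m) → EndsInZero (siteList v)
  siteList-endsInZero []      = [] , refl , []
  siteList-endsInZero (y ∷ v) with xs , eq , 0<xs ← siteList-endsInZero v =
    suc (toℕ y) ∷ xs , cong (suc (toℕ y) ∷_) eq , s≤s z≤n ∷ 0<xs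

  siteList-↭ : (π : Word n) → IsPermutation π → siteList π ↭ downFrom (suc n)
  siteList-↭ {n} π (inj , surj) = unique-↭ (siteList-unique π inj) (Unq.downFrom⁺ (suc n)) to from
    where
    to : ∀ {s} → s ∈ siteList π → s ∈ downFrom (suc n)
    to s∈ with ∈-siteList⁻ π s∈
    ... | inj₁ refl       = ∈-downFrom⁺ (s≤s z≤n)
    ... | inj₂ (j , refl) = ∈-downFrom⁺ (s≤s (FinP.toℕ<n (lookup π j)))
    from : ∀ {s} → s ∈ downFrom (suc n) → s ∈ siteList π
    from {zero}  _  = 0∈siteList π
    from {suc s} s∈ with j , eq ← surjective⇒strictlySurjective surj (fromℕ< (≤-pred (∈-downFrom⁻ s∈))) =
      subst (_∈ siteList π) (cong suc (trans (cong toℕ eq) (FinP.toℕ-fromℕ< _))) (∈-siteList⁺ π j)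

  siteList-onto : ∀ n m xs → length xs ≡ m → All (0 <_) xs → All (_≤ n) xs →
                  ∃[ v ] siteList {n} {m} v ≡ xs ++ 0 ∷ []
  siteList-onto n zero    []           _    _             _             = [] , refl
  siteList-onto n (suc m) (zero ∷ xs)  _    (() ∷ _)      _
  siteList-onto n (suc m) (suc x ∷ xs) len (_ ∷ 0<xs) (x<n ∷ xs≤)
    with v , eq ← siteList-onto n m xs (suc-injective len) 0<xs xs≤ =
    fromℕ< x<n ∷ v , cong₂ _∷_ (cong suc (FinP.toℕ-fromℕ< x<n)) eq

  ∈-𝒮⁻ : {π : Word n} → π ∈ 𝒮 n → IsPermutation π
  ∈-𝒮⁻ {n} π∈ = proj₂ (∈-filter⁻ isPermutation? {xs = vectors (allFin n) n} π∈)

  ∈-𝒮⁺ : (π : Word n) → IsPermutation π → π ∈ 𝒮 n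
  ∈-𝒮⁺ π = ∈-filter⁺ isPermutation? (∈-vectors ∈-allFin π)

  𝒮-unique : ∀ n → Unique (𝒮 n)
  𝒮-unique n = Unq.filter⁺ isPermutation? (vectors-unique (Unq.allFin⁺ n) n)

  siteList-codes : ∀ n → map siteList (𝒮 n) ↭ map arrange (codes n)
  siteList-codes n = unique-↭
    (Unq.map⁺ (λ {v} {w} → siteList-injective v w) (𝒮-unique n))
    (map-unique arrange (λ {a} {b} a∈ b∈ → arrange-injective a b (∈-codes⁻ a a∈) (∈-codes⁻ b b∈)) (codes-unique n))
    to from
    where
    to : ∀ {ys} → ys ∈ map siteList (𝒮 n) → ys ∈ map arrange (codes n)
    to ys∈ with π , π∈ , refl ← ∈-map⁻ siteList ys∈
      with a , ok , eq ← arrange-onto n (siteList π) (siteList-endsInZero π) (siteList-↭ π (∈-𝒮⁻ π∈))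
      = subst (_∈ map arrange (codes n)) eq (∈-map⁺ arrange (∈-codes⁺ a ok))

    from : ∀ {ys} → ys ∈ map arrange (codes n) → ys ∈ map siteList (𝒮 n)
    from ys∈ with a , a∈ , refl ← ∈-map⁻ arrange ys∈ =
      realize (siteList-onto n n xs len 0<xs
        (All.tabulate λ x∈ → ∈-arrange⁻ a (subst (_ ∈_) (sym xs≡) (∈-++⁺ˡ x∈))))
      where
      ends = arrange-endsInZero a (∈-codes⁻ a a∈)
      xs   = proj₁ ends
      xs≡  = proj₁ (proj₂ ends)
      0<xs = proj₂ (proj₂ ends)
      len : length xs ≡ n
      len = suc-injective (begin
        suc (length xs)           ≡⟨ ↭P.↭-length (↭P.∷↭∷ʳ 0 xs) ⟩
        length (xs ++ 0 ∷ [])     ≡⟨ cong length xs≡ ⟨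
        length (arrange a)        ≡⟨ ↭P.↭-length (arrange-↭ a) ⟩
        length (downFrom (suc n)) ≡⟨ length-downFrom (suc n) ⟩
        suc n                     ∎)
        where
        open ≡-Reasoning
      realize : ∃[ π ] siteList π ≡ xs ++ 0 ∷ [] → arrange a ∈ map siteList (𝒮 n)
      realize (π , π≡) = subst (_∈ map siteList (𝒮 n)) eq
        (∈-map⁺ siteList (∈-𝒮⁺ π (inj , strictlySurjective⇒surjective (injective⇒surjective (lookup π) inj))))
        where
        eq : siteList π ≡ arrange a
        eq = trans π≡ (sym xs≡)
        inj : Injective _≡_ _≡_ (lookup π)
        inj = siteList-unique⁻ π (subst Unique (sym eq) (unique-resp-↭ (↭-sym (arrange-↭ a)) (Unq.downFrom⁺ (suc n))))

open PermutationCodes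

-- Statistics of permutations
module PermutationStatistics where
  -- The final 0 is disregarded.
  isMinimum : ℕ → List ℕ → Bool
  isMinimum y ys = (0 <ᵇ y) ∧ all (λ z → (z ≡ᵇ 0) ∨ (y <ᵇ z)) ys

  minima : List ℕ → ℕ
  minima []       = 0
  minima (y ∷ ys) = χ (isMinimum y ys) + minima ys

  all-insertBefore : ∀ p x c ys → p x ≡ true → all p (insertBefore x c ys) ≡ all p ys
  all-insertBefore p x c []       px rewrite px = refl
  all-insertBefore p x c (y ∷ ys) px with c ≡ᵇ y
  ... | true  rewrite px = refl
  ... | false = cong (p y ∧_) (all-insertBefore p x c ys px)

  isMinimum-insertBefore : ∀ {x} y c ys → y < x → isMinimum y (insertBefore x c ys) ≡ isMinimum y ys
  isMinimum-insertBefore {x} y c ys y<x = cong ((0 <ᵇ y) ∧_) (all-insertBefore _ x c ys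
    (trans (cong ((x ≡ᵇ 0) ∨_) (<⇒<ᵇ≡true y<x)) (∨-zeroʳ (x ≡ᵇ 0))))

  -- A maximum is a right-to-left minimum only in front of the final 0, and it does not
  -- affect the minimality of the elements to the left of it.
  minima-insertBefore : ∀ x c ys → EndsInZero ys → All (_< x) ys → c ∈ ys → 0 < x →
                        minima (insertBefore x c ys) ≡ χ (c ≡ᵇ 0) + minima ys
  minima-insertBefore x c _ ([] , refl , _) (_ ∷ []) (here refl) 0<x
    rewrite insertBefore-here x c [] | <⇒<ᵇ≡true 0<x = refl
  minima-insertBefore x c _ ([] , refl , _) _ (there ()) _
  minima-insertBefore x c _ (y ∷ xs , refl , 0<y ∷ 0<xs) (y<x ∷ ys<x) c∈ 0<x with c ≟ y
  ... | yes refl rewrite insertBefore-here x c (xs ++ 0 ∷ []) = begin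
    χ (isMinimum x (c ∷ ys)) + minima (c ∷ ys)
      ≡⟨ cong (λ b → χ b + minima (c ∷ ys)) (not-minimum c 0<y y<x) ⟩
    minima (c ∷ ys)
      ≡⟨ cong (λ b → χ b + minima (c ∷ ys)) (≢⇒≡ᵇ (≢-sym (<⇒≢ 0<y))) ⟨
    χ (c ≡ᵇ 0) + minima (c ∷ ys) ∎
    where
    open ≡-Reasoning
    ys = xs ++ 0 ∷ []
    not-minimum : ∀ c → 0 < c → c < x → isMinimum x (c ∷ ys) ≡ false
    not-minimum (suc c) _ c<x rewrite ≥⇒<ᵇ≡false (<⇒≤ c<x) = ∧-zeroʳ (0 <ᵇ x)
  ... | no c≢y rewrite insertBefore-there x (xs ++ 0 ∷ []) c≢y = begin
    χ (isMinimum y (insertBefore x c ys)) + minima (insertBefore x c ys)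
      ≡⟨ cong₂ (λ b t → χ b + t) (isMinimum-insertBefore y c ys y<x)
           (minima-insertBefore x c ys (xs , refl , 0<xs) ys<x (Any.tail c≢y c∈) 0<x) ⟩
    χ (isMinimum y ys) + (χ (c ≡ᵇ 0) + minima ys)
      ≡⟨ lem (χ (isMinimum y ys)) (χ (c ≡ᵇ 0)) (minima ys) ⟩
    χ (c ≡ᵇ 0) + minima (y ∷ ys) ∎
    where
    open ≡-Reasoning
    ys = xs ++ 0 ∷ []
    lem : ∀ a b c → a + (b + c) ≡ b + (a + c)
    lem = solve-∀

  arrange-< : (a : Vec ℕ n) → All (_< suc n) (arrange a)
  arrange-< a = All.tabulate λ c∈ → s≤s (∈-arrange⁻ a c∈)

  minima-arrange : (a : Vec ℕ n) → IsCode a → minima (arrange a) ≡ zeros a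
  minima-arrange []               _          = refl
  minima-arrange {suc n} (c ∷ as) (c≤n , ok) = trans
    (minima-insertBefore (suc n) c (arrange as) (arrange-endsInZero as ok) (arrange-< as) (∈-arrange⁺ as c≤n) (s≤s z≤n))
    (cong (χ (c ≡ᵇ 0) +_) (minima-arrange as ok))

  startsWith : ℕ → List ℕ → Bool
  startsWith v []      = false
  startsWith v (z ∷ _) = v ≡ᵇ z

  -- Second entry of a descent.
  bottom : ℕ → List ℕ → Bool
  bottom v []       = false
  bottom v (y ∷ ys) = (startsWith v ys ∧ (v <ᵇ y)) ∨ bottom v ys

  bottom-insertBefore-here : ∀ v {x c} ys → c < x → bottom v (x ∷ c ∷ ys) ≡ (v ≡ᵇ c) ∨ bottom v (c ∷ ys)
  bottom-insertBefore-here v {x} {c} ys c<x with v ≟ c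
  ... | yes refl rewrite ≡ᵇ-refl v | <⇒<ᵇ≡true c<x = refl
  ... | no v≢c   rewrite ≢⇒≡ᵇ v≢c = refl

  -- Directly to the right of a maximum, c is the second entry of a descent.  The element
  -- that was to the left of c is now followed by a maximum, so the only descent that can
  -- be lost is one that ends in c.
  bottom-insertBefore : ∀ v x c ys → All (_< x) ys → c ∈ ys →
                        bottom v (insertBefore x c ys) ≡ (v ≡ᵇ c) ∨ bottom v ys
  bottom-insertBefore v x c (y ∷ ys) (y<x ∷ ys<x) c∈ with c ≟ y
  ... | yes refl rewrite insertBefore-here x c ys = bottom-insertBefore-here v ys y<x
  ... | no c≢y rewrite insertBefore-there x ys c≢y = begin
    (startsWith v (insertBefore x c ys) ∧ (v <ᵇ y)) ∨ bottom v (insertBefore x c ys)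
      ≡⟨ cong ((startsWith v (insertBefore x c ys) ∧ (v <ᵇ y)) ∨_) (bottom-insertBefore v x c ys ys<x (Any.tail c≢y c∈)) ⟩
    (startsWith v (insertBefore x c ys) ∧ (v <ᵇ y)) ∨ ((v ≡ᵇ c) ∨ bottom v ys)
      ≡⟨ swap-∨ (startsWith v (insertBefore x c ys) ∧ (v <ᵇ y)) (v ≡ᵇ c) (bottom v ys) ⟩
    ((v ≡ᵇ c) ∨ (startsWith v (insertBefore x c ys) ∧ (v <ᵇ y))) ∨ bottom v ys
      ≡⟨ cong (_∨ bottom v ys) (head-case ys (Any.tail c≢y c∈)) ⟩
    ((v ≡ᵇ c) ∨ (startsWith v ys ∧ (v <ᵇ y))) ∨ bottom v ys
      ≡⟨ ∨-assoc (v ≡ᵇ c) _ _ ⟩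
    (v ≡ᵇ c) ∨ bottom v (y ∷ ys) ∎
    where
    open ≡-Reasoning
    swap-∨ : ∀ p q r → p ∨ (q ∨ r) ≡ (q ∨ p) ∨ r
    swap-∨ p q r = trans (sym (∨-assoc p q r)) (cong (_∨ r) (∨-comm p q))
    head-case : ∀ zs → c ∈ zs →
      (v ≡ᵇ c) ∨ (startsWith v (insertBefore x c zs) ∧ (v <ᵇ y)) ≡ (v ≡ᵇ c) ∨ (startsWith v zs ∧ (v <ᵇ y))
    head-case (z ∷ zs) c∈zs with c ≟ z
    ... | no c≢z rewrite insertBefore-there x zs c≢z = refl
    ... | yes refl rewrite insertBefore-here x c zs with v ≟ c
    ...   | yes refl rewrite ≡ᵇ-refl v = refl
    ...   | no v≢c rewrite ≢⇒≡ᵇ v≢c with v ≟ x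
    ...     | no v≢x rewrite ≢⇒≡ᵇ v≢x = refl
    ...     | yes refl rewrite ≥⇒<ᵇ≡false (<⇒≤ y<x) = ∧-zeroʳ (v ≡ᵇ v)

  bottom-arrange : ∀ v (a : Vec ℕ n) → IsCode a → bottom v (arrange a) ≡ mem v a
  bottom-arrange v []               _          = refl
  bottom-arrange {suc n} v (c ∷ as) (c≤n , ok) = trans
    (bottom-insertBefore v (suc n) c (arrange as) (arrange-< as) (∈-arrange⁺ as c≤n))
    (cong ((v ≡ᵇ c) ∨_) (bottom-arrange v as ok))

  insertion-rise : (a : Vec ℕ (suc k)) → ∀ {v} → v < k →
                   Tree.rise insertionTree a v ≡ precedes (suc (suc v)) (suc v) (arrange a)
  insertion-rise {suc k} (c ∷ as@(_ ∷ _)) {v} v<sk with v ≟ k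
  ... | yes refl rewrite ≡ᵇ-refl v = refl
  ... | no v≢k rewrite ≢⇒≡ᵇ v≢k = trans (insertion-rise as v<k)
      (sym (precedes-insertBefore {suc (suc v)} {suc v} {suc (suc k)} c (arrange as)
        (v≢k ∘ suc-injective ∘ suc-injective) (<⇒≢ (m≤n⇒m≤1+n (s≤s v<k)))))
    where v<k = ≤∧≢⇒< (≤-pred v<sk) v≢k

  true⇔true : ∀ {x y} → (x ≡ true → y ≡ true) → (y ≡ true → x ≡ true) → x ≡ y
  true⇔true {false} {false} _  _    = refl
  true⇔true {true}  {true}  _  _    = refl
  true⇔true {true}  {false} to _    = sym (to refl)
  true⇔true {false} {true}  _  from = from refl

  all⇒ : ∀ (p : ℕ → Bool) ys → all p ys ≡ true → ∀ {z} → z ∈ ys → p z ≡ true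
  all⇒ p (y ∷ ys) eq (here refl) = ∧-conicalˡ _ _ eq
  all⇒ p (y ∷ ys) eq (there z∈)  = all⇒ p ys (∧-conicalʳ (p y) _ eq) z∈

  all⇐ : ∀ (p : ℕ → Bool) ys → (∀ {z} → z ∈ ys → p z ≡ true) → all p ys ≡ true
  all⇐ p []       h = refl
  all⇐ p (y ∷ ys) h = cong₂ _∧_ (h (here refl)) (all⇐ p ys (h ∘ there))

  minima-siteList : (v : Vec (Fin n) m) (b : Fin m → Bool) →
    (∀ j → b j ≡ true → ∀ l → j Fin.< l → lookup v j Fin.< lookup v l) →
    (∀ j → (∀ l → j Fin.< l → lookup v j Fin.< lookup v l) → b j ≡ true) →
    cnt b ≡ minima (siteList v)
  minima-siteList []      b to from = refl
  minima-siteList (y ∷ v) b to from = cong₂ (λ c t → χ c + t)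
    head-min
    (minima-siteList v (b ∘ suc) (λ j bj l j<l → to (suc j) bj (suc l) (s≤s j<l))
      (λ j h → from (suc j) λ { (suc l) j<l → h l (≤-pred j<l) }))
    where
    p : ℕ → Bool
    p z = (z ≡ᵇ 0) ∨ (suc (toℕ y) <ᵇ z)
    smaller : b zero ≡ true → ∀ {z} → z ≡ 0 ⊎ ∃[ j ] z ≡ suc (toℕ (lookup v j)) → p z ≡ true
    smaller b0 (inj₁ refl)       = refl
    smaller b0 (inj₂ (j , refl)) = <⇒<ᵇ≡true (s≤s (to zero b0 (suc j) (s≤s z≤n)))
    head-min : b zero ≡ all p (siteList v)
    head-min = true⇔true
      (λ b0 → all⇐ p (siteList v) λ z∈ → smaller b0 (∈-siteList⁻ v z∈))
      (λ all-true → from zero λ { (suc l) _ →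
        ≤-pred (does⇒ (suc (toℕ y) <? suc (toℕ (lookup v l))) (all⇒ p (siteList v) all-true (∈-siteList⁺ v l))) })

  startsWith-fresh : ∀ w ys → w ∉ ys → startsWith w ys ≡ false
  startsWith-fresh w []       _  = refl
  startsWith-fresh w (z ∷ zs) w∉ = ≢⇒≡ᵇ (w∉ ∘ here)

  bottom-fresh : ∀ w ys → w ∉ ys → bottom w ys ≡ false
  bottom-fresh w []       w∉ = refl
  bottom-fresh w (y ∷ ys) w∉ = cong₂ _∨_ (cong (_∧ (w <ᵇ y)) (startsWith-fresh w ys (w∉ ∘ there))) (bottom-fresh w ys (w∉ ∘ there))

  Descends : Vec (Fin n) m → Fin m → Set
  Descends v j = ∃[ i ] (i ⋖ j × lookup v j Fin.< lookup v i)

  descends⇒bottom : (v : Vec (Fin n) m) → ∀ j → Descends v j → bottom (suc (toℕ (lookup v j))) (siteList v) ≡ true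
  descends⇒bottom (y ∷ z ∷ v) (suc zero)    (zero , _ , lt) rewrite ≡ᵇ-refl (toℕ z) | <⇒<ᵇ≡true lt = refl
  descends⇒bottom (y ∷ v)     (suc (suc j)) (zero , () , _)
  descends⇒bottom (y ∷ v)     (suc j)       (suc i , i⋖j , lt)
    rewrite descends⇒bottom v j (i , suc-injective i⋖j , lt) = ∨-zeroʳ _

  bottom⇒descends : (v : Vec (Fin n) m) → Injective _≡_ _≡_ (lookup v) → ∀ j →
                    bottom (suc (toℕ (lookup v j))) (siteList v) ≡ true → Descends v j
  bottom⇒descends (y ∷ v) inj zero eq
    with () ← trans (sym eq) (cong₂ _∨_
           (cong (_∧ (suc (toℕ y) <ᵇ suc (toℕ y))) (startsWith-fresh _ (siteList v) (∉-tail y v inj)))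
           (bottom-fresh _ (siteList v) (∉-tail y v inj)))
  bottom⇒descends (y ∷ v@(z ∷ _)) inj (suc j) eq
    with startsWith (suc (toℕ (lookup v j))) (siteList v) in starts | suc (toℕ (lookup v j)) <ᵇ suc (toℕ y) in lt
  ... | true | true with refl ← tail-injective y v inj {j} {zero}
          (FinP.toℕ-injective (does⇒ (toℕ (lookup v j) ≟ toℕ z) starts))
      = zero , refl , does⇒ (toℕ z <? toℕ y) lt
  ... | true | false with i , i⋖j , l ← bottom⇒descends v (tail-injective y v inj) j eq = suc i , cong suc i⋖j , l
  ... | false | _ with i , i⋖j , l ← bottom⇒descends v (tail-injective y v inj) j eq = suc i , cong suc i⋖j , l

  -- The element looked for occurs to the left of position j, since the search stops
  -- there.
  precedes⇒ : (v : Vec (Fin n) m) → ∀ j w → precedes (suc w) (suc (toℕ (lookup v j))) (siteList v) ≡ true →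
              ∃[ i ] (i Fin.< j × w ≡ toℕ (lookup v i))
  precedes⇒ (y ∷ v) zero w eq with () ← trans (sym eq) (cong (λ b → not b ∧ ((w ≡ᵇ toℕ y) ∨ precedes (suc w) (suc (toℕ y)) (siteList v))) (≡ᵇ-refl (toℕ y)))
  precedes⇒ (y ∷ v) (suc j) w eq with w ≟ toℕ y
  ... | yes w≡y = zero , s≤s z≤n , w≡y
  ... | no w≢y rewrite ≢⇒≡ᵇ w≢y with i , i<j , w≡ ← precedes⇒ v j w (∧-conicalʳ (not (toℕ (lookup v j) ≡ᵇ toℕ y)) _ eq)
      = suc i , s≤s i<j , w≡

  precedes⇐ : (v : Vec (Fin n) m) → Injective _≡_ _≡_ (lookup v) → ∀ i j → i Fin.< j →
              precedes (suc (toℕ (lookup v i))) (suc (toℕ (lookup v j))) (siteList v) ≡ true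
  precedes⇐ (y ∷ v) inj i (suc j) i<j
    rewrite ≢⇒≡ᵇ {toℕ (lookup v j)} {toℕ y} (λ eq → case inj {suc j} {zero} (FinP.toℕ-injective eq) of λ ())
    with i
  ... | zero   rewrite ≡ᵇ-refl (toℕ y) = refl
  ... | suc i′ rewrite precedes⇐ v (tail-injective y v inj) i′ j (≤-pred i<j) = ∨-zeroʳ _

  cnt-siteList : (v : Vec (Fin n) m) (q : ℕ → Bool) →
                 cnt (λ j → q (suc (toℕ (lookup v j)))) + χ (q 0) ≡ Σ∈ (siteList v) (χ ∘ q)
  cnt-siteList []      q = sym (+-identityʳ _)
  cnt-siteList (y ∷ v) q = trans (+-assoc (χ (q (suc (toℕ y)))) _ _) (cong (χ (q (suc (toℕ y))) +_) (cnt-siteList v q))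

  Σ∈-downFrom-suc : ∀ k (f : ℕ → ℕ) → Σ∈ (downFrom (suc k)) f ≡ Σ∈ (downFrom k) (f ∘ suc) + f 0
  Σ∈-downFrom-suc zero    f = +-identityʳ _
  Σ∈-downFrom-suc (suc k) f = trans (cong (f (suc k) +_) (Σ∈-downFrom-suc k f)) (sym (+-assoc (f (suc k)) _ _))

  -- The statistics in terms of the arrangement, a form in which they can be transported
  -- from codes to permutations.
  siteStats : ℕ → List ℕ → Triple
  siteStats k ys = minima ys
    , Σ∈ (downFrom k) (λ v → χ (not (bottom (suc v) ys) ∧ precedes (suc (suc v)) (suc v) ys))
    , Σ∈ (downFrom k) (λ v → χ (not (bottom (suc v) ys) ∧ not (precedes (suc (suc v)) (suc v) ys)))

  siteStats-arrange : (a : Vec ℕ (suc k)) → IsCode a → siteStats k (arrange a) ≡ Tree.stats insertionTree a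
  siteStats-arrange {k} a ok = cong₂ _,_ (minima-arrange a ok) (cong₂ _,_
    (Σ∈-cong (downFrom k) λ v v∈ → cong₂ (λ b c → χ (not b ∧ c))
      (bottom-arrange (suc v) a ok) (sym (insertion-rise a (∈-downFrom⁻ v∈))))
    (Σ∈-cong (downFrom k) λ v v∈ → cong₂ (λ b c → χ (not b ∧ not c))
      (bottom-arrange (suc v) a ok) (sym (insertion-rise a (∈-downFrom⁻ v∈)))))

  module PermutationStats {k} (π : Word (suc k)) (perm : IsPermutation π)
                          (a : Vec ℕ (suc k)) (ok : IsCode a) (π≡a : siteList π ≡ arrange a) where
    open Tree insertionTree using (unusedRises; unusedRests; rise)
    open ≡-Reasoning

    used : ℕ → Bool
    used v = mem (suc v) a

    count-values : ∀ (q : ℕ → Bool) → cnt (λ j → q (suc (toℕ (lookup π j)))) ≡ Σ∈ (downFrom (suc k)) (χ ∘ q ∘ suc)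
    count-values q = +-cancelʳ-≡ (χ (q 0)) _ _ (begin
      cnt (λ j → q (suc (toℕ (lookup π j)))) + χ (q 0)     ≡⟨ cnt-siteList π q ⟩
      Σ∈ (siteList π) (χ ∘ q)                              ≡⟨ Σ∈-↭ (χ ∘ q) (siteList-↭ π perm) ⟩
      Σ∈ (downFrom (suc (suc k))) (χ ∘ q)                  ≡⟨ Σ∈-downFrom-suc (suc k) (χ ∘ q) ⟩
      Σ∈ (downFrom (suc k)) (χ ∘ q ∘ suc) + χ (q 0)        ∎)

    bottom-used : ∀ w → bottom w (siteList π) ≡ mem w a
    bottom-used w = trans (cong (bottom w) π≡a) (bottom-arrange w a ok)

    descent-used : ∀ j → does (isDescent? π j) ≡ used (toℕ (lookup π j))
    descent-used j = does-≡ (isDescent? π j)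
      (λ desc → trans (sym (bottom-used _)) (descends⇒bottom π j desc))
      (λ u → bottom⇒descends π (proj₁ perm) j (trans (bottom-used _) u))

    descent-unused : ∀ j → used (toℕ (lookup π j)) ≡ false → ¬ IsDescent π j
    descent-unused j u desc with () ← trans (sym u) (trans (sym (bottom-used _)) (descends⇒bottom π j desc))

    silly-values : ℕ → Bool
    silly-values w = not (mem w a) ∧ precedes (suc w) w (arrange a)

    silly-value : ∀ j → does (isSilly? π j) ≡ silly-values (suc (toℕ (lookup π j)))
    silly-value j = does-≡ (isSilly? π j) to from
      where
      w = toℕ (lookup π j)
      to : IsSilly π j → silly-values (suc w) ≡ true
      to (start , _ , i , i<j , w⋖) = cong₂ _∧_ (not-bottom start)
        (trans (cong (λ u → precedes (suc u) (suc w) (arrange a)) w⋖)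
          (trans (cong (precedes _ (suc w)) (sym π≡a)) (precedes⇐ π (proj₁ perm) i j i<j)))
        where
        not-bottom : toℕ j ≡ 0 ⊎ ∃[ i ] (i ⋖ j × lookup π i Fin.< lookup π j) → not (used w) ≡ true
        not-bottom start with used w in u
        ... | false = refl
        ... | true with i , i⋖j , lt ← bottom⇒descends π (proj₁ perm) j (trans (bottom-used _) u) | start
        ...   | inj₁ j≡0 = contradiction (trans i⋖j j≡0) λ ()
        ...   | inj₂ (i′ , i′⋖j , lt′)
                with refl ← FinP.toℕ-injective {i = i} {j = i′} (suc-injective (trans i⋖j (sym i′⋖j)))
                = contradiction lt (<-asym lt′)
      from : silly-values (suc w) ≡ true → IsSilly π j
      from eq with i , i<j , sw≡ ← precedes⇒ π j (suc w) (trans (cong (precedes _ _) π≡a) (∧-conicalʳ (not (used w)) _ eq))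
        = start j refl , subst (_< suc k) (sym sw≡) (FinP.toℕ<n (lookup π i)) , i , i<j , sw≡
        where
        start : ∀ j′ → j ≡ j′ → toℕ j′ ≡ 0 ⊎ ∃[ i ] (i ⋖ j′ × lookup π i Fin.< lookup π j′)
        start zero     _    = inj₁ refl
        start (suc j′) refl with <-cmp (toℕ (lookup π (inject₁ j′))) (toℕ (lookup π (suc j′)))
        ... | tri< lt _ _ = inj₂ (inject₁ j′ , cong suc (FinP.toℕ-inject₁ j′) , lt)
        ... | tri≈ _ e _  = contradiction
          (trans (sym (FinP.toℕ-inject₁ j′)) (cong toℕ (proj₁ perm (FinP.toℕ-injective e)))) (<⇒≢ ≤-refl)
        ... | tri> _ _ gt = contradiction (inject₁ j′ , cong suc (FinP.toℕ-inject₁ j′) , gt)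
          (descent-unused (suc j′) (not-true (∧-conicalˡ _ _ eq)))
          where
          not-true : ∀ {b} → not b ≡ true → b ≡ false
          not-true {false} _ = refl

    rmin-stat : rmin π ≡ zeros a
    rmin-stat = begin
      rmin π
        ≡⟨ #≡cnt (isRightToLeftMin? π) ⟩
      cnt (does ∘ isRightToLeftMin? π)
        ≡⟨ minima-siteList π _ (λ j → does⇒ (isRightToLeftMin? π j)) (λ j → dec-true (isRightToLeftMin? π j)) ⟩
      minima (siteList π)
        ≡⟨ cong minima π≡a ⟩
      minima (arrange a)
        ≡⟨ minima-arrange a ok ⟩
      zeros a ∎

    silly-stat : p-silly π ≡ unusedRises a
    silly-stat = begin
      p-silly π
        ≡⟨ #≡cnt (isSilly? π) ⟩
      cnt (does ∘ isSilly? π)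
        ≡⟨ cnt-cong _ (λ j → silly-values (suc (toℕ (lookup π j)))) silly-value ⟩
      cnt (λ j → silly-values (suc (toℕ (lookup π j))))
        ≡⟨ count-values silly-values ⟩
      χ (silly-values (suc k)) + Σ∈ (downFrom k) (χ ∘ silly-values ∘ suc)
        ≡⟨ cong₂ (λ b t → χ b + t) top (Σ∈-cong (downFrom k) λ v v∈ →
             cong (λ b → χ (not (used v) ∧ b)) (sym (insertion-rise a (∈-downFrom⁻ v∈)))) ⟩
      unusedRises a ∎
      where
      precedes-absent : ∀ x y zs → x ∉ zs → precedes x y zs ≡ false
      precedes-absent x y []       x∉ = refl
      precedes-absent x y (z ∷ zs) x∉ rewrite ≢⇒≡ᵇ {x} {z} (x∉ ∘ here) | precedes-absent x y zs (x∉ ∘ there) = ∧-zeroʳ _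
      top : silly-values (suc k) ≡ false
      top = trans (cong (not (used k) ∧_) (precedes-absent _ _ (arrange a) λ x∈ → 1+n≰n (∈-arrange⁻ a x∈))) (∧-zeroʳ _)

    des-complement : des π + (unusedRises a + unusedRests a) ≡ k
    des-complement = begin
      des π + (X + Y)
        ≡⟨ cong₂ _+_ des≡ (sym (Σ∈-+ (downFrom k) _ _)) ⟩
      Σ∈ (downFrom k) (χ ∘ used) + Σ∈ (downFrom k) (λ v → χ (not (used v) ∧ rise a v) + χ (not (used v) ∧ not (rise a v)))
        ≡⟨ Σ∈-+ (downFrom k) _ _ ⟨
      Σ∈ (downFrom k) (λ v → χ (used v) + (χ (not (used v) ∧ rise a v) + χ (not (used v) ∧ not (rise a v))))
        ≡⟨ (Σ∈-cong (downFrom k) λ v _ → one (used v) (rise a v)) ⟩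
      Σ∈ (downFrom k) (λ _ → 1)
        ≡⟨ ones k ⟩
      k ∎
      where
      X = unusedRises a
      Y = unusedRests a
      des≡ : des π ≡ Σ∈ (downFrom k) (χ ∘ used)
      des≡ = begin
        des π
          ≡⟨ #≡cnt (isDescent? π) ⟩
        cnt (does ∘ isDescent? π)
          ≡⟨ cnt-cong _ (λ j → mem (suc (toℕ (lookup π j))) a) descent-used ⟩
        cnt (λ j → mem (suc (toℕ (lookup π j))) a)
          ≡⟨ count-values (λ w → mem w a) ⟩
        χ (used k) + Σ∈ (downFrom k) (χ ∘ used)
          ≡⟨ cong (λ b → χ b + Σ∈ (downFrom k) (χ ∘ used)) (mem-fresh a ok (suc k) ≤-refl) ⟩
        Σ∈ (downFrom k) (χ ∘ used) ∎
      one : ∀ u r → χ u + (χ (not u ∧ r) + χ (not u ∧ not r)) ≡ 1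
      one true  _     = refl
      one false true  = refl
      one false false = refl
      ones : ∀ k → Σ∈ (downFrom k) (λ _ → 1) ≡ k
      ones zero    = refl
      ones (suc k) = cong suc (ones k)

    des-stat : des π ≡ k ∸ (unusedRises a + unusedRests a)
    des-stat = begin
      des π                ≡⟨ m+n∸n≡m (des π) u ⟨
      (des π + u) ∸ u      ≡⟨ cong (_∸ u) des-complement ⟩
      k ∸ u                ∎
      where
      u = unusedRises a + unusedRests a

open PermutationStatistics

-- Generating functions
module GeneratingFunctions where
  module _ {c ℓ} (R : CommutativeSemiring c ℓ) where
    open GeneratingFunction R using (Carrier; _^_; ∑)
    private module R = CommutativeSemiring R
    open import Relation.Binary.Reasoning.Setoid R.setoid

    ∑-cong : ∀ {A : Set ℓ₁} (xs : List A) {f g : A → Carrier} → (∀ x → x ∈ xs → f x ≡ g x) → ∑ xs f R.≈ ∑ xs g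
    ∑-cong []       eq = R.refl
    ∑-cong (x ∷ xs) eq = R.+-cong (R.reflexive (eq x (here refl))) (∑-cong xs λ y → eq y ∘ there)

    ∑-↭ : ∀ {A : Set ℓ₁} {xs ys : List A} (f : A → Carrier) → xs ↭ ys → ∑ xs f R.≈ ∑ ys f
    ∑-↭ f Perm.refl          = R.refl
    ∑-↭ f (Perm.prep x p)    = R.+-congˡ (∑-↭ f p)
    ∑-↭ f (Perm.swap x y p)  = begin
      f x R.+ (f y R.+ _)  ≈⟨ R.+-assoc _ _ _ ⟨
      (f x R.+ f y) R.+ _  ≈⟨ R.+-cong (R.+-comm _ _) (∑-↭ f p) ⟩
      (f y R.+ f x) R.+ _  ≈⟨ R.+-assoc _ _ _ ⟩
      f y R.+ (f x R.+ _)  ∎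
    ∑-↭ f (Perm.trans p q)   = R.trans (∑-↭ f p) (∑-↭ f q)

    ∑-map : ∀ {A : Set ℓ₁} {B : Set ℓ₂} (h : A → B) (xs : List A) (f : B → Carrier) → ∑ (map h xs) f R.≈ ∑ xs (f ∘ h)
    ∑-map h xs f = R.reflexive (cong (List.foldr R._+_ R.0#) (sym (map-∘ xs)))

    module _ (k : ℕ) (s x w : Carrier) where

      -- Of the values 1, …, k those that are used give the exponent of w.
      term : Triple → Carrier
      term (z , X , Y) = s ^ z R.* x ^ X R.* w ^ (k ∸ (X + Y))

      permutation-side : ∑ (𝒮 (suc k)) (λ π → s ^ rmin π R.* x ^ p-silly π R.* w ^ des π)
                         R.≈ ∑ (map (Tree.stats insertionTree) (codes (suc k))) term
      permutation-side = begin
        ∑ (𝒮 (suc k)) (λ π → s ^ rmin π R.* x ^ p-silly π R.* w ^ des π)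
          ≈⟨ ∑-cong (𝒮 (suc k)) (λ π π∈ → on-permutation π (∈-𝒮⁻ π∈)) ⟩
        ∑ (𝒮 (suc k)) (term ∘ siteStats k ∘ siteList)
          ≈⟨ ∑-map siteList (𝒮 (suc k)) _ ⟨
        ∑ (map siteList (𝒮 (suc k))) (term ∘ siteStats k)
          ≈⟨ ∑-↭ _ (siteList-codes (suc k)) ⟩
        ∑ (map arrange (codes (suc k))) (term ∘ siteStats k)
          ≈⟨ ∑-map arrange (codes (suc k)) _ ⟩
        ∑ (codes (suc k)) (term ∘ siteStats k ∘ arrange)
          ≈⟨ ∑-cong (codes (suc k)) (λ a a∈ → cong term (siteStats-arrange a (∈-codes⁻ a a∈))) ⟩
        ∑ (codes (suc k)) (term ∘ Tree.stats insertionTree)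
          ≈⟨ ∑-map (Tree.stats insertionTree) (codes (suc k)) term ⟨
        ∑ (map (Tree.stats insertionTree) (codes (suc k))) term ∎
        where
        on-permutation : (π : Word (suc k)) → IsPermutation π →
          s ^ rmin π R.* x ^ p-silly π R.* w ^ des π ≡ term (siteStats k (siteList π))
        on-permutation π perm
          with a , ok , a≡π ← arrange-onto (suc k) (siteList π) (siteList-endsInZero π) (siteList-↭ π perm)
          = trans
            (cong₂ R._*_ (cong₂ (λ i j → s ^ i R.* x ^ j) rmin-stat silly-stat)
              (cong (w ^_) des-stat))
            (cong term (trans (sym (siteStats-arrange a ok)) (cong (siteStats k) a≡π)))
          where open PermutationStats π perm a ok (sym a≡π)

      matching-side : ∑ (𝒩 (suc k)) (λ M → s ^ min M R.* x ^ rne M R.* w ^ (int M ∸ 1))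
                      R.≈ ∑ (map (Tree.stats numericalTree) (codes (suc k))) term
      matching-side = begin
        ∑ (𝒩 (suc k)) (λ M → s ^ min M R.* x ^ rne M R.* w ^ (int M ∸ 1))
          ≈⟨ ∑-cong (𝒩 (suc k)) (λ M M∈ → on-matching M (∈-𝒩⁻ M∈)) ⟩
        ∑ (𝒩 (suc k)) (term ∘ Tree.stats numericalTree ∘ matchingCode)
          ≈⟨ ∑-map matchingCode (𝒩 (suc k)) _ ⟨
        ∑ (map matchingCode (𝒩 (suc k))) (term ∘ Tree.stats numericalTree)
          ≈⟨ ∑-↭ _ (matchingCode-↭ (suc k)) ⟩
        ∑ (codes (suc k)) (term ∘ Tree.stats numericalTree)
          ≈⟨ ∑-map (Tree.stats numericalTree) (codes (suc k)) term ⟨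
        ∑ (map (Tree.stats numericalTree) (codes (suc k))) term ∎
        where
        on-matching : (M : ArcVec (suc k)) → IsMatching M × NoLeftNesting M →
          s ^ min M R.* x ^ rne M R.* w ^ (int M ∸ 1) ≡ term (Tree.stats numericalTree (matchingCode M))
        on-matching M (isM , noNest) = cong₂ R._*_ (cong₂ (λ i j → s ^ i R.* x ^ j) min-stat rne-stat)
          (cong (w ^_) int-stat)
          where open MatchingStats M isM noNest

open GeneratingFunctions

theorem8p3 : ∀ {c ℓ} (R : CommutativeSemiring c ℓ) (n : ℕ) → .{{_ : NonZero n}} →
    let open GeneratingFunction R in
    (s x w : Carrier) →
    (∑[ π ∈ 𝒮 n ] (s ^ rmin π * x ^ p-silly π * w ^ des π))
    ≈ (∑[ M ∈ 𝒩 n ] (s ^ min M * x ^ rne M * w ^ (int M ∸ 1)))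
theorem8p3 R (suc k) s x w = begin
  _ ≈⟨ permutation-side R k s x w ⟩
  _ ≈⟨ ∑-↭ R (term R k s x w) (stats-↭ insertionTree numericalTree k) ⟩
  _ ≈⟨ matching-side R k s x w ⟨
  _ ∎
  where open import Relation.Binary.Reasoning.Setoid (CommutativeSemiring.setoid R)
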